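{- Let $[\mathbf{Set},\mathbf{Set}]_S$ be the category of small endofunctors of $\mathbf{Set}$, with the monoidal structure given by Day convolution $\star$ and unit $\mathrm{Id}$. For every small functor $F:\mathbf{Set}\to\mathbf{Set}$ the free monoid on $F$ in this monoidal category (i.e. the free applicative functor on $F$) exists, and its carrier is $\mu X.\ \mathrm{Id}+F\star X$, the carrier of the initial algebra of the endofunctor $X\mapsto\mathrm{Id}+F\star X$ of $[\mathbf{Set},\mathbf{Set}]_S$.
   Context: A functor $\mathbf{Set}\to\mathbf{Set}$ is small if it is a left Kan extension along the inclusion of a small subcategory of $\mathbf{Set}$. For small $F,G$ the Day convolution is the coend $$(F\star G)(B)=\int^{C,D}F(C)\times G(D)\times B^{C\times D},$$ which makes $([\mathbf{Set},\mathbf{Set}]_S,\star,\mathrm{Id})$ a symmetric monoidal category. Monoids in it correspond to applicative functors (lax monoidal endofunctors of $(\mathbf{Set},\times,1)$) whose underlying functor is small. The free monoid on an object $F$ of a monoidal category is a monoid $F^*$ together with a morphism $\mathrm{ins}:F\to F^*$ such that for every monoid $G$ and every morphism $f:F\to G$ of the underlying category there is a unique monoid homomorphism $\bar f:F^*\to G$ with $\bar f\circ\mathrm{ins}=f$. -}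

module Defs where

open import Level using (Level; _⊔_; suc)
open import Data.Product using (Σ-syntax; _×_; _,_; proj₁; proj₂)
open import Data.Product.Relation.Binary.Pointwise.NonDependent using (_×ₛ_)
open import Data.Sum using (_⊎_; inj₁; inj₂)
open import Data.Sum.Relation.Binary.Pointwise using (_⊎ₛ_; inj₁; inj₂)
open import Data.Unit.Polymorphic using (⊤; tt)
open import Function.Bundles using (Func)
import Function.Construct.Composition as Comp
import Function.Construct.Identity as Ident
open import Function.Relation.Binary.Setoid.Equality using ()
  renaming (setoid to infixr 9 _⇨_)
open import Relation.Binary.Bundles using (Setoid)
open import Relation.Binary.Structures using (IsEquivalence)

open Func using (to; cong)

private
  variable
    o h e o′ h′ e′ o″ h″ e″ ℓ : Level

record Category (o h e : Level) : Set (suc (o ⊔ h ⊔ e)) where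
  infix  4 _≈_ _⇒_
  infixr 9 _∘_
  field
    Obj : Set o
    _⇒_ : Obj → Obj → Set h
    _≈_ : ∀ {A B} → A ⇒ B → A ⇒ B → Set e
    id  : ∀ {A} → A ⇒ A
    _∘_ : ∀ {A B C} → B ⇒ C → A ⇒ B → A ⇒ C
    equiv     : ∀ {A B} → IsEquivalence (_≈_ {A} {B})
    assoc     : ∀ {A B C D} {f : A ⇒ B} {g : B ⇒ C} {k : C ⇒ D} →
                (k ∘ g) ∘ f ≈ k ∘ (g ∘ f)
    identityˡ : ∀ {A B} {f : A ⇒ B} → id ∘ f ≈ f
    identityʳ : ∀ {A B} {f : A ⇒ B} → f ∘ id ≈ f
    ∘-resp-≈  : ∀ {A B C} {f f′ : A ⇒ B} {g g′ : B ⇒ C} →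
                g ≈ g′ → f ≈ f′ → g ∘ f ≈ g′ ∘ f′

Op : Category o h e → Category o h e
Op C = record
  { Obj = Obj
  ; _⇒_ = λ A B → B ⇒ A
  ; _≈_ = _≈_
  ; id = id
  ; _∘_ = λ g f → f ∘ g
  ; equiv = equiv
  ; assoc = IsEquivalence.sym equiv assoc
  ; identityˡ = identityʳ
  ; identityʳ = identityˡ
  ; ∘-resp-≈ = λ p q → ∘-resp-≈ q p
  }
  where open Category C

infixr 2 _×ᶜ_
_×ᶜ_ : Category o h e → Category o′ h′ e′ → Category (o ⊔ o′) (h ⊔ h′) (e ⊔ e′)
C ×ᶜ D = record
  { Obj = C.Obj × D.Obj
  ; _⇒_ = λ (A , A′) (B , B′) → (A C.⇒ B) × (A′ D.⇒ B′)
  ; _≈_ = λ (f , f′) (g , g′) → (f C.≈ g) × (f′ D.≈ g′)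
  ; id = C.id , D.id
  ; _∘_ = λ (g , g′) (f , f′) → (g C.∘ f) , (g′ D.∘ f′)
  ; equiv = record
    { refl = IsEquivalence.refl C.equiv , IsEquivalence.refl D.equiv
    ; sym = λ (p , q) → IsEquivalence.sym C.equiv p , IsEquivalence.sym D.equiv q
    ; trans = λ (p , q) (p′ , q′) →
        IsEquivalence.trans C.equiv p p′ , IsEquivalence.trans D.equiv q q′
    }
  ; assoc = C.assoc , D.assoc
  ; identityˡ = C.identityˡ , D.identityˡ
  ; identityʳ = C.identityʳ , D.identityʳ
  ; ∘-resp-≈ = λ (p , p′) (q , q′) → C.∘-resp-≈ p q , D.∘-resp-≈ p′ q′
  }
  where
    module C = Category C
    module D = Category D

record Functor (C : Category o h e) (D : Category o′ h′ e′)
               : Set (o ⊔ h ⊔ e ⊔ o′ ⊔ h′ ⊔ e′) where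
  private
    module C = Category C
    module D = Category D
  field
    F₀ : C.Obj → D.Obj
    F₁ : ∀ {A B} → A C.⇒ B → F₀ A D.⇒ F₀ B
    identity     : ∀ {A} → F₁ (C.id {A}) D.≈ D.id
    homomorphism : ∀ {X Y Z} {f : X C.⇒ Y} {g : Y C.⇒ Z} →
                   F₁ (g C.∘ f) D.≈ F₁ g D.∘ F₁ f
    F-resp-≈     : ∀ {A B} {f g : A C.⇒ B} → f C.≈ g → F₁ f D.≈ F₁ g

open Functor using (F₀; F₁)

opF : {C : Category o h e} {D : Category o′ h′ e′} →
      Functor C D → Functor (Op C) (Op D)
opF F = record
  { F₀ = F.F₀ ; F₁ = F.F₁ ; identity = F.identity
  ; homomorphism = F.homomorphism ; F-resp-≈ = F.F-resp-≈ }
  where module F = Functor F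

infixr 9 _∘F_
_∘F_ : {C : Category o h e} {D : Category o′ h′ e′} {E : Category o″ h″ e″} →
       Functor D E → Functor C D → Functor C E
_∘F_ {E = E} G F = record
  { F₀ = λ A → G.F₀ (F.F₀ A)
  ; F₁ = λ f → G.F₁ (F.F₁ f)
  ; identity = trans (G.F-resp-≈ F.identity) G.identity
  ; homomorphism = trans (G.F-resp-≈ F.homomorphism) G.homomorphism
  ; F-resp-≈ = λ p → G.F-resp-≈ (F.F-resp-≈ p)
  }
  where
    module F = Functor F
    module G = Functor G
    open module E {A} {B} = IsEquivalence (Category.equiv E {A} {B})

record NaturalTransformation {C : Category o h e} {D : Category o′ h′ e′}
                             (F G : Functor C D) : Set (o ⊔ h ⊔ h′ ⊔ e′) where
  private
    module C = Category C
    module D = Category D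
  field
    η       : ∀ A → F₀ F A D.⇒ F₀ G A
    commute : ∀ {A B} (f : A C.⇒ B) → η B D.∘ F₁ F f D.≈ F₁ G f D.∘ η A

open NaturalTransformation using (η; commute)

record BinaryCoproducts (C : Category o h e) : Set (o ⊔ h ⊔ e) where
  open Category C
  infixr 6 _+_
  field
    _+_     : Obj → Obj → Obj
    i₁      : ∀ {A B} → A ⇒ A + B
    i₂      : ∀ {A B} → B ⇒ A + B
    [_,_]   : ∀ {A B X} → A ⇒ X → B ⇒ X → A + B ⇒ X
    inject₁ : ∀ {A B X} {f : A ⇒ X} {g : B ⇒ X} → [ f , g ] ∘ i₁ ≈ f
    inject₂ : ∀ {A B X} {f : A ⇒ X} {g : B ⇒ X} → [ f , g ] ∘ i₂ ≈ g
    unique  : ∀ {A B X} {f : A ⇒ X} {g : B ⇒ X} (u : A + B ⇒ X) →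
              u ∘ i₁ ≈ f → u ∘ i₂ ≈ g → u ≈ [ f , g ]

module _ {C : Category o h e} (T : Functor C C) where
  open Category C

  record Algebra : Set (o ⊔ h) where
    field
      carrier   : Obj
      structure : F₀ T carrier ⇒ carrier

  record InitialAlgebra : Set (o ⊔ h ⊔ e) where
    field
      algebra : Algebra
    open Algebra algebra public
    field
      fold        : (B : Algebra) → carrier ⇒ Algebra.carrier B
      fold-hom    : (B : Algebra) →
                    fold B ∘ structure ≈ Algebra.structure B ∘ F₁ T (fold B)
      fold-unique : (B : Algebra) (u : carrier ⇒ Algebra.carrier B) →
                    u ∘ structure ≈ Algebra.structure B ∘ F₁ T u → u ≈ fold B

record Monoidal (C : Category o h e) : Set (o ⊔ h ⊔ e) where
  open Category C
  field
    ⊗    : Functor (C ×ᶜ C) C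
    unit : Obj

  infixr 10 _⊗₀_ _⊗₁_
  _⊗₀_ : Obj → Obj → Obj
  X ⊗₀ Y = F₀ ⊗ (X , Y)

  _⊗₁_ : ∀ {A B A′ B′} → A ⇒ B → A′ ⇒ B′ → A ⊗₀ A′ ⇒ B ⊗₀ B′
  f ⊗₁ g = F₁ ⊗ (f , g)

  field
    λ⇒ : ∀ {X} → unit ⊗₀ X ⇒ X
    λ⇐ : ∀ {X} → X ⇒ unit ⊗₀ X
    ρ⇒ : ∀ {X} → X ⊗₀ unit ⇒ X
    ρ⇐ : ∀ {X} → X ⇒ X ⊗₀ unit
    α⇒ : ∀ {X Y Z} → (X ⊗₀ Y) ⊗₀ Z ⇒ X ⊗₀ (Y ⊗₀ Z)
    α⇐ : ∀ {X Y Z} → X ⊗₀ (Y ⊗₀ Z) ⇒ (X ⊗₀ Y) ⊗₀ Z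

    λ-isoˡ : ∀ {X} → λ⇐ {X} ∘ λ⇒ ≈ id
    λ-isoʳ : ∀ {X} → λ⇒ {X} ∘ λ⇐ ≈ id
    ρ-isoˡ : ∀ {X} → ρ⇐ {X} ∘ ρ⇒ ≈ id
    ρ-isoʳ : ∀ {X} → ρ⇒ {X} ∘ ρ⇐ ≈ id
    α-isoˡ : ∀ {X Y Z} → α⇐ {X} {Y} {Z} ∘ α⇒ ≈ id
    α-isoʳ : ∀ {X Y Z} → α⇒ {X} {Y} {Z} ∘ α⇐ ≈ id

    λ-natural : ∀ {X Y} {f : X ⇒ Y} → λ⇒ ∘ (id ⊗₁ f) ≈ f ∘ λ⇒
    ρ-natural : ∀ {X Y} {f : X ⇒ Y} → ρ⇒ ∘ (f ⊗₁ id) ≈ f ∘ ρ⇒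
    α-natural : ∀ {X Y Z X′ Y′ Z′} {f : X ⇒ X′} {g : Y ⇒ Y′} {k : Z ⇒ Z′} →
                α⇒ ∘ ((f ⊗₁ g) ⊗₁ k) ≈ (f ⊗₁ (g ⊗₁ k)) ∘ α⇒

    triangle : ∀ {X Y} → (id ⊗₁ λ⇒) ∘ α⇒ {X} {unit} {Y} ≈ ρ⇒ ⊗₁ id
    pentagon : ∀ {W X Y Z} →
               (id ⊗₁ α⇒) ∘ (α⇒ ∘ (α⇒ ⊗₁ id)) ≈
               α⇒ {W} {X} {Y ⊗₀ Z} ∘ α⇒ {W ⊗₀ X} {Y} {Z}

module _ {C : Category o h e} (M : Monoidal C) where
  open Category C
  open Monoidal M

  record Monoid : Set (o ⊔ h ⊔ e) where
    field
      carrier   : Obj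
      mult      : carrier ⊗₀ carrier ⇒ carrier
      unit⇒     : unit ⇒ carrier
      mult-assoc     : mult ∘ (mult ⊗₁ id) ≈ mult ∘ ((id ⊗₁ mult) ∘ α⇒)
      mult-identityˡ : mult ∘ (unit⇒ ⊗₁ id) ≈ λ⇒
      mult-identityʳ : mult ∘ (id ⊗₁ unit⇒) ≈ ρ⇒

  record MonoidHom (G H : Monoid) : Set (h ⊔ e) where
    private
      module G = Monoid G
      module H = Monoid H
    field
      arr            : G.carrier ⇒ H.carrier
      preserves-mult : arr ∘ G.mult ≈ H.mult ∘ (arr ⊗₁ arr)
      preserves-unit : arr ∘ G.unit⇒ ≈ H.unit⇒

  record FreeMonoid (F : Obj) : Set (o ⊔ h ⊔ e) where
    field
      monoid : Monoid
    open Monoid monoid public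
    field
      ins           : F ⇒ carrier
      extend        : (G : Monoid) → F ⇒ Monoid.carrier G → MonoidHom monoid G
      extend-ins    : (G : Monoid) (f : F ⇒ Monoid.carrier G) →
                      MonoidHom.arr (extend G f) ∘ ins ≈ f
      extend-unique : (G : Monoid) (f : F ⇒ Monoid.carrier G)
                      (u : MonoidHom monoid G) →
                      MonoidHom.arr u ∘ ins ≈ f →
                      MonoidHom.arr u ≈ MonoidHom.arr (extend G f)

  module _ (coproducts : BinaryCoproducts C) where
    open BinaryCoproducts coproducts

    unit+_⊗- : Obj → Functor C C
    unit+ F ⊗- = record
      { F₀ = λ X → unit + F ⊗₀ X
      ; F₁ = λ f → [ i₁ , i₂ ∘ (id ⊗₁ f) ]
      ; identity = sym (unique id identityˡ
          (trans identityˡ (sym (trans (∘-resp-≈ refl ⊗.identity) identityʳ))))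
      ; homomorphism = λ {_} {_} {_} {f} {g} → sym (unique _
          (trans assoc (trans (∘-resp-≈ refl inject₁) inject₁))
          (trans assoc (trans (∘-resp-≈ refl inject₂)
            (trans (sym assoc) (trans (∘-resp-≈ inject₂ refl) (trans assoc
              (∘-resp-≈ refl (trans (sym ⊗.homomorphism)
                (⊗.F-resp-≈ (identityˡ , refl))))))))))
      ; F-resp-≈ = λ p → unique _ inject₁
          (trans inject₂ (∘-resp-≈ refl (⊗.F-resp-≈ (refl , p))))
      }
      where
        module ⊗ = Functor ⊗
        open module E {A} {B} = IsEquivalence (equiv {A} {B})

-- The category Set.  Coends are quotients, so a "set" is a setoid; "small"
-- means of level ℓ.
SET : ∀ ℓ → Category (suc ℓ) ℓ ℓ
SET ℓ = record
  { Obj = Setoid ℓ ℓ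
  ; _⇒_ = Func
  ; _≈_ = λ {A} {B} → Setoid._≈_ (A ⇨ B)
  ; id = λ {A} → Ident.function A
  ; _∘_ = λ g f → Comp.function f g
  ; equiv = λ {A} {B} → Setoid.isEquivalence (A ⇨ B)
  ; assoc = λ {_} {_} {_} {D} _ → Setoid.refl D
  ; identityˡ = λ {_} {B} _ → Setoid.refl B
  ; identityʳ = λ {_} {B} _ → Setoid.refl B
  ; ∘-resp-≈ = λ {_} {_} {C} {_} {f′} {g} p q x →
      Setoid.trans C (cong g (q x)) (p (to f′ x))
  }

Endofunctor : ∀ ℓ → Set (suc ℓ)
Endofunctor ℓ = Functor (SET ℓ) (SET ℓ)

∣_∣ : Setoid ℓ ℓ → Set ℓ
∣_∣ = Setoid.Carrier

infix 4 _[_≈_]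
_[_≈_] : (A : Setoid ℓ ℓ) → ∣ A ∣ → ∣ A ∣ → Set ℓ
A [ x ≈ y ] = Setoid._≈_ A x y

infixr 9 _⊙_
_⊙_ : {A B C : Setoid ℓ ℓ} → Func B C → Func A B → Func A C
g ⊙ f = Comp.function f g

idₛ : {A : Setoid ℓ ℓ} → Func A A
idₛ {A = A} = Ident.function A

infixr 8 _×₁_
_×₁_ : {A B C D : Setoid ℓ ℓ} → Func A B → Func C D → Func (A ×ₛ C) (B ×ₛ D)
f ×₁ g = record { to = λ (x , y) → to f x , to g y
                ; cong = λ (p , q) → cong f p , cong g q }

module _ {C : Category o h e} {D : Category o′ h′ e′} {E : Category o″ h″ e″} where
  private
    module E = Category E

  record IsLeftKanExtension (K : Functor C D) (G : Functor C E) (L : Functor D E)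
                            (ι : NaturalTransformation G (L ∘F K))
                            : Set (o ⊔ h ⊔ e ⊔ o′ ⊔ h′ ⊔ e′ ⊔ o″ ⊔ h″ ⊔ e″) where
    field
      factor        : (M : Functor D E) → NaturalTransformation G (M ∘F K) →
                      NaturalTransformation L M
      factor-ι      : (M : Functor D E) (γ : NaturalTransformation G (M ∘F K)) →
                      ∀ a → η (factor M γ) (F₀ K a) E.∘ η ι a E.≈ η γ a
      factor-unique : (M : Functor D E) (γ : NaturalTransformation G (M ∘F K))
                      (σ : NaturalTransformation L M) →
                      (∀ a → η σ (F₀ K a) E.∘ η ι a E.≈ η γ a) →
                      ∀ A → η σ A E.≈ η (factor M γ) A

-- A small, not necessarily full, subcategory of SET.  There is no equality of
-- objects of SET, so the objects are given as a family, which may repeat.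
record SmallSubcategory (ℓ : Level) : Set (suc ℓ) where
  field
    Ob      : Set ℓ
    ⟦_⟧     : Ob → Setoid ℓ ℓ
    IsArrow : ∀ {a b} → Func ⟦ a ⟧ ⟦ b ⟧ → Set ℓ
    resp    : ∀ {a b} {f g : Func ⟦ a ⟧ ⟦ b ⟧} →
              (⟦ a ⟧ ⇨ ⟦ b ⟧) [ f ≈ g ] → IsArrow f → IsArrow g
    id-arrow : ∀ {a} → IsArrow (idₛ {A = ⟦ a ⟧})
    ∘-arrow  : ∀ {a b c} {f : Func ⟦ a ⟧ ⟦ b ⟧} {g : Func ⟦ b ⟧ ⟦ c ⟧} →
               IsArrow g → IsArrow f → IsArrow (g ⊙ f)

  category : Category ℓ ℓ ℓ
  category = record
    { Obj = Ob
    ; _⇒_ = λ a b → Σ[ f ∈ Func ⟦ a ⟧ ⟦ b ⟧ ] IsArrow f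
    ; _≈_ = λ {a} {b} (f , _) (g , _) → (⟦ a ⟧ ⇨ ⟦ b ⟧) [ f ≈ g ]
    ; id = idₛ , id-arrow
    ; _∘_ = λ (g , q) (f , p) → g ⊙ f , ∘-arrow q p
    ; equiv = λ {a} {b} → record
      { refl = λ _ → Setoid.refl ⟦ b ⟧
      ; sym = λ p x → Setoid.sym ⟦ b ⟧ (p x)
      ; trans = λ p q x → Setoid.trans ⟦ b ⟧ (p x) (q x) }
    ; assoc = λ {_} {_} {_} {d} _ → Setoid.refl ⟦ d ⟧
    ; identityˡ = λ {_} {b} _ → Setoid.refl ⟦ b ⟧
    ; identityʳ = λ {_} {b} _ → Setoid.refl ⟦ b ⟧
    ; ∘-resp-≈ = λ {_} {_} {c} {_} {f′} {g} p q x →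
        Setoid.trans ⟦ c ⟧ (cong (proj₁ g) (q x)) (p (to (proj₁ f′) x))
    }

  inclusion : Functor category (SET ℓ)
  inclusion = record
    { F₀ = ⟦_⟧
    ; F₁ = proj₁
    ; identity = λ {a} _ → Setoid.refl ⟦ a ⟧
    ; homomorphism = λ {_} {_} {c} _ → Setoid.refl ⟦ c ⟧
    ; F-resp-≈ = λ p → p
    }

record IsSmall {ℓ} (F : Endofunctor ℓ) : Set (suc ℓ) where
  field
    J     : SmallSubcategory ℓ
    base  : Functor (SmallSubcategory.category J) (SET ℓ)
    ι     : NaturalTransformation base (F ∘F SmallSubcategory.inclusion J)
    isLan : IsLeftKanExtension (SmallSubcategory.inclusion J) base F ι

SmallFunctor : ∀ ℓ → Set (suc ℓ)
SmallFunctor ℓ = Σ[ F ∈ Endofunctor ℓ ] IsSmall F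

-- [Set,Set]_S
SmallEndo : ∀ ℓ → Category (suc ℓ) (suc ℓ) (suc ℓ)
SmallEndo ℓ = record
  { Obj = SmallFunctor ℓ
  ; _⇒_ = λ (F , _) (G , _) → NaturalTransformation F G
  ; _≈_ = λ {F} {G} σ τ → ∀ A → (F₀ (proj₁ F) A ⇨ F₀ (proj₁ G) A) [ η σ A ≈ η τ A ]
  ; id = λ {F} → record
    { η = λ _ → idₛ
    ; commute = λ {_} {B} _ _ → Setoid.refl (F₀ (proj₁ F) B) }
  ; _∘_ = λ {_} {_} {H} τ σ → record
    { η = λ A → η τ A ⊙ η σ A
    ; commute = λ {A} {B} f x → Setoid.trans (F₀ (proj₁ H) B)
        (cong (η τ B) (commute σ f x)) (commute τ f (to (η σ A) x)) }
  ; equiv = λ {_} {G} → record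
    { refl = λ A _ → Setoid.refl (F₀ (proj₁ G) A)
    ; sym = λ p A x → Setoid.sym (F₀ (proj₁ G) A) (p A x)
    ; trans = λ p q A x → Setoid.trans (F₀ (proj₁ G) A) (p A x) (q A x) }
  ; assoc = λ {_} {_} {_} {K} A _ → Setoid.refl (F₀ (proj₁ K) A)
  ; identityˡ = λ {_} {G} A _ → Setoid.refl (F₀ (proj₁ G) A)
  ; identityʳ = λ {_} {G} A _ → Setoid.refl (F₀ (proj₁ G) A)
  ; ∘-resp-≈ = λ {_} {_} {H} {_} {σ′} {τ} p q A x →
      Setoid.trans (F₀ (proj₁ H) A) (cong (η τ A) (q A x)) (p A (to (η σ′ A) x))
  }

module _ {C : Category o h e} (P : Functor (Op C ×ᶜ C) (SET ℓ)) where
  open Category C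

  record Cowedge (Z : Setoid ℓ ℓ) : Set (o ⊔ h ⊔ ℓ) where
    field
      ψ         : ∀ A → Func (F₀ P (A , A)) Z
      dinatural : ∀ {A B} (f : A ⇒ B) (p : ∣ F₀ P (B , A) ∣) →
                  Z [ to (ψ A) (to (F₁ P (f , id)) p) ≈ to (ψ B) (to (F₁ P (id , f)) p) ]

  open Cowedge

  record IsCoend {Z : Setoid ℓ ℓ} (w : Cowedge Z) : Set (o ⊔ h ⊔ suc ℓ) where
    field
      universal        : ∀ {Y} → Cowedge Y → Func Z Y
      universal-β      : ∀ {Y} (v : Cowedge Y) A p →
                         Y [ to (universal v) (to (ψ w A) p) ≈ to (ψ v A) p ]
      universal-unique : ∀ {Y} (v : Cowedge Y) (u : Func Z Y) →
                         (∀ A p → Y [ to u (to (ψ w A) p) ≈ to (ψ v A) p ]) →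
                         ∀ z → Y [ to u z ≈ to (universal v) z ]

-- ((C′ , D′) , (C , D)) ↦ F C × G D × B^(C′ × D′)
dayIntegrand : Endofunctor ℓ → Endofunctor ℓ → Setoid ℓ ℓ →
               Functor (Op (SET ℓ ×ᶜ SET ℓ) ×ᶜ (SET ℓ ×ᶜ SET ℓ)) (SET ℓ)
dayIntegrand F G B = record
  { F₀ = λ ((C′ , D′) , (C , D)) → (F.F₀ C ×ₛ G.F₀ D) ×ₛ ((C′ ×ₛ D′) ⇨ B)
  ; F₁ = λ ((f′ , g′) , (f , g)) → (F.F₁ f ×₁ G.F₁ g) ×₁ record
      { to = λ k → k ⊙ (f′ ×₁ g′)
      ; cong = λ p (c , d) → p (to f′ c , to g′ d) }
  ; identity = λ ((x , y) , k) →
      (F.identity x , G.identity y) , λ _ → Setoid.refl B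
  ; homomorphism = λ ((x , y) , k) →
      (F.homomorphism x , G.homomorphism y) , λ _ → Setoid.refl B
  ; F-resp-≈ = λ ((p′ , q′) , (p , q)) ((x , y) , k) →
      (F.F-resp-≈ p x , G.F-resp-≈ q y) , λ (c , d) → cong k (p′ c , q′ d)
  }
  where
    module F = Functor F
    module G = Functor G

-- H is F ⋆ G: each H B is the coend, and the action of H on maps is the
-- one induced by postcomposition on B^(C × D).
record IsDayConvolution {ℓ} (F G H : Endofunctor ℓ) : Set (suc ℓ) where
  field
    cowedge : ∀ B → Cowedge (dayIntegrand F G B) (F₀ H B)
    isCoend : ∀ B → IsCoend (dayIntegrand F G B) (cowedge B)
    action  : ∀ {A B} (k : Func A B) C D x y (u : Func (C ×ₛ D) A) →
              F₀ H B [ to (F₁ H k) (to (Cowedge.ψ (cowedge A) (C , D)) ((x , y) , u))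
                     ≈ to (Cowedge.ψ (cowedge B) (C , D)) ((x , y) , k ⊙ u) ]

-- P ⊠ Q is the coend ∫^a P a × Q a over a small category.
module _ {J : Category ℓ ℓ ℓ} (P : Functor J (SET ℓ)) (Q : Functor (Op J) (SET ℓ)) where
  private
    module J = Category J
    module P = Functor P
    module Q = Functor Q

  record Element : Set ℓ where
    constructor ⟨_,_,_⟩
    field
      index : J.Obj
      left  : ∣ P.F₀ index ∣
      right : ∣ Q.F₀ index ∣

  data _∼_ : Element → Element → Set ℓ where
    step : ∀ {a b} (f : a J.⇒ b) {x x′ y y′} →
           P.F₀ b [ to (P.F₁ f) x ≈ x′ ] → Q.F₀ a [ y ≈ to (Q.F₁ f) y′ ] →
           ⟨ a , x , y ⟩ ∼ ⟨ b , x′ , y′ ⟩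
    ∼-sym   : ∀ {u v} → u ∼ v → v ∼ u
    ∼-trans : ∀ {u v w} → u ∼ v → v ∼ w → u ∼ w

  ∼-≈ : ∀ {a x x′ y y′} → P.F₀ a [ x ≈ x′ ] → Q.F₀ a [ y ≈ y′ ] →
        ⟨ a , x , y ⟩ ∼ ⟨ a , x′ , y′ ⟩
  ∼-≈ {a} {x} {x′} {y} {y′} p q =
    step J.id (Setoid.trans (P.F₀ a) (P.identity x) p)
              (Setoid.trans (Q.F₀ a) q (Setoid.sym (Q.F₀ a) (Q.identity y′)))

  infixr 7 _⊠_
  _⊠_ : Setoid ℓ ℓ
  _⊠_ = record
    { Carrier = Element
    ; _≈_ = _∼_
    ; isEquivalence = record
      { refl = λ {u} → ∼-≈ (Setoid.refl (P.F₀ (Element.index u)))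
                            (Setoid.refl (Q.F₀ (Element.index u)))
      ; sym = ∼-sym
      ; trans = ∼-trans }
    }

  module _ {Z : Setoid ℓ ℓ} (t : ∀ a → ∣ P.F₀ a ∣ → ∣ Q.F₀ a ∣ → ∣ Z ∣)
           (t-step : ∀ {a b} (f : a J.⇒ b) {x x′ y y′} →
                     P.F₀ b [ to (P.F₁ f) x ≈ x′ ] → Q.F₀ a [ y ≈ to (Q.F₁ f) y′ ] →
                     Z [ t a x y ≈ t b x′ y′ ]) where

    ⊠-elim : Func _⊠_ Z
    ⊠-elim = record { to = to′ ; cong = cong′ }
      where
        to′ : Element → ∣ Z ∣
        to′ ⟨ a , x , y ⟩ = t a x y
        cong′ : ∀ {u v} → u ∼ v → Z [ to′ u ≈ to′ v ]
        cong′ (step f p q) = t-step f p q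
        cong′ (∼-sym p) = Setoid.sym Z (cong′ p)
        cong′ (∼-trans p q) = Setoid.trans Z (cong′ p) (cong′ q)

⊠-map : {J : Category ℓ ℓ ℓ} (P : Functor J (SET ℓ)) {Q Q′ : Functor (Op J) (SET ℓ)} →
        NaturalTransformation Q Q′ → Func (P ⊠ Q) (P ⊠ Q′)
⊠-map P {Q} {Q′} σ = ⊠-elim P Q (λ a x y → ⟨ a , x , to (η σ a) y ⟩)
  (λ {a} f {y′ = y′} p q → step f p
    (Setoid.trans (F₀ Q′ a) (cong (η σ a) q) (commute σ f y′)))

-- A ↦ B^A
power : Setoid ℓ ℓ → Functor (Op (SET ℓ)) (SET ℓ)
power B = record
  { F₀ = λ A → A ⇨ B
  ; F₁ = λ f → record { to = λ k → k ⊙ f ; cong = λ p x → p (to f x) }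
  ; identity = λ _ _ → Setoid.refl B
  ; homomorphism = λ _ _ → Setoid.refl B
  ; F-resp-≈ = λ p k x → cong k (p x)
  }

power-map : {A B : Setoid ℓ ℓ} → Func A B → NaturalTransformation (power A) (power B)
power-map {B = B} k = record
  { η = λ _ → record { to = λ u → k ⊙ u ; cong = λ p x → cong k (p x) }
  ; commute = λ _ _ _ → Setoid.refl B
  }

-- The pointwise left Kan extension B ↦ ∫^a P a × B^⟦ a ⟧.
module PointwiseLan (J : SmallSubcategory ℓ)
                    (P : Functor (SmallSubcategory.category J) (SET ℓ)) where
  open SmallSubcategory J
  private
    module P = Functor P

  power∘J : Setoid ℓ ℓ → Functor (Op category) (SET ℓ)
  power∘J B = power B ∘F opF inclusion

  power∘J-map : ∀ {A B} → Func A B → NaturalTransformation (power∘J A) (power∘J B)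
  power∘J-map k = record
    { η = λ a → η (power-map k) ⟦ a ⟧
    ; commute = λ f → commute (power-map k) (proj₁ f) }

  Lan : Endofunctor ℓ
  Lan = record
    { F₀ = λ B → P ⊠ power∘J B
    ; F₁ = λ k → ⊠-map P (power∘J-map k)
    ; identity = λ {A} w → Setoid.refl (P ⊠ power∘J A)
    ; homomorphism = λ {_} {_} {C} w → Setoid.refl (P ⊠ power∘J C)
    ; F-resp-≈ = λ {_} {B} p w → ∼-≈ P (power∘J B) (Setoid.refl (P.F₀ (Element.index w)))
                                     (λ x → p (to (Element.right w) x))
    }

  Lan-ι : NaturalTransformation P (Lan ∘F inclusion)
  Lan-ι = record
    { η = λ a → record
      { to = λ x → ⟨ a , x , idₛ ⟩
      ; cong = λ p → ∼-≈ P (power∘J ⟦ a ⟧) p (λ _ → Setoid.refl ⟦ a ⟧) }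
    ; commute = λ {a} {b} f x → ∼-sym
        (step f (Setoid.refl (P.F₀ b)) (λ _ → Setoid.refl ⟦ b ⟧))
    }

  module _ (M : Endofunctor ℓ) (γ : NaturalTransformation P (M ∘F inclusion)) where
    private
      module M = Functor M

    Lan-factor : NaturalTransformation Lan M
    Lan-factor = record
      { η = λ B → ⊠-elim P (power∘J B) (λ a x k → to (M.F₁ k) (to (η γ a) x))
        (λ {a} {b} f {x} {x′} {k} {k′} p q → let open Setoid (M.F₀ B) in
          trans (M.F-resp-≈ q (to (η γ a) x))
          (trans (M.homomorphism (to (η γ a) x))
          (cong (M.F₁ k′)
            (Setoid.trans (M.F₀ ⟦ b ⟧) (Setoid.sym (M.F₀ ⟦ b ⟧) (commute γ f x))
                                       (cong (η γ b) p)))))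
      ; commute = λ _ w → M.homomorphism (to (η γ (Element.index w)) (Element.left w))
      }

-- A small functor agrees with the pointwise extension.
module Small (F : SmallFunctor ℓ) where
  open Functor (proj₁ F) public using ()
    renaming (F₀ to Fun; F₁ to fmap; identity to fmap-id;
              homomorphism to fmap-∘; F-resp-≈ to fmap-resp)
  open IsSmall (proj₂ F) public
  open SmallSubcategory J public
  open IsLeftKanExtension isLan public
  open PointwiseLan J base public

  ι-arrow : ∀ {a b} (f : Category._⇒_ category a b) {x x′} →
            F₀ base b [ to (F₁ base f) x ≈ x′ ] →
            Fun ⟦ b ⟧ [ to (fmap (proj₁ f)) (to (η ι a) x) ≈ to (η ι b) x′ ]
  ι-arrow {a} {b} f {x} p = Setoid.trans (Fun ⟦ b ⟧)
    (Setoid.sym (Fun ⟦ b ⟧) (commute ι f x)) (cong (η ι b) p)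

  decompose : NaturalTransformation (proj₁ F) Lan
  decompose = factor Lan Lan-ι

  compose : NaturalTransformation Lan (proj₁ F)
  compose = Lan-factor (proj₁ F) ι

  compose∘decompose : ∀ A x → Fun A [ to (η compose A) (to (η decompose A) x) ≈ x ]
  compose∘decompose A x = trans (factor-unique (proj₁ F) ι round
      (λ a x → Setoid.trans (Fun ⟦ a ⟧) (cong (η compose ⟦ a ⟧) (factor-ι Lan Lan-ι a x))
                                        (fmap-id (to (η ι a) x)))
      A x)
    (sym (factor-unique (proj₁ F) ι (Category.id (SmallEndo _) {F})
      (λ a _ → Setoid.refl (Fun ⟦ a ⟧)) A x))
    where
      open Setoid (Fun A)
      round : NaturalTransformation (proj₁ F) (proj₁ F)
      round = record
        { η = λ A → η compose A ⊙ η decompose A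
        ; commute = λ {A} {B} f x → Setoid.trans (Fun B)
            (cong (η compose B) (commute decompose f x))
            (commute compose f (to (η decompose A) x)) }

  decompose∘compose : ∀ A w → F₀ Lan A [ to (η decompose A) (to (η compose A) w) ≈ w ]
  decompose∘compose A ⟨ a , x , k ⟩ = trans (commute decompose k (to (η ι a) x))
      (cong (F₁ Lan k) (factor-ι Lan Lan-ι a x))
    where open Setoid (F₀ Lan A)

-- A criterion for smallness: every element comes, naturally, from a
-- small full subcategory.
module _ {I : Set ℓ} (⟦_⟧ᵢ : I → Setoid ℓ ℓ) where

  full : SmallSubcategory ℓ
  full = record
    { Ob = I
    ; ⟦_⟧ = ⟦_⟧ᵢ
    ; IsArrow = λ _ → ⊤
    ; resp = λ _ _ → tt
    ; id-arrow = tt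
    ; ∘-arrow = λ _ _ → tt
    }

  module Criterion (F : Endofunctor ℓ) where
    private
      module F = Functor F

    restriction : Functor (SmallSubcategory.category full) (SET ℓ)
    restriction = F ∘F SmallSubcategory.inclusion full

    open PointwiseLan full restriction public

    private
      ι′ : NaturalTransformation restriction (F ∘F SmallSubcategory.inclusion full)
      ι′ = record { η = λ _ → idₛ
                  ; commute = λ {_} {b} _ _ → Setoid.refl (F.F₀ ⟦ b ⟧ᵢ) }

    recompose : NaturalTransformation Lan F
    recompose = Lan-factor F ι′

    module _ (s : NaturalTransformation F Lan)
             (recompose-s : ∀ A x → F.F₀ A [ to (η recompose A) (to (η s A) x) ≈ x ]) where

      isSmall : IsSmall F
      isSmall = record
        { J = full
        ; base = restriction
        ; ι = ι′
        ; isLan = record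
          { factor = fac
          ; factor-ι = λ M γ i x → Setoid.trans (F₀ M ⟦ i ⟧ᵢ)
              (cong (η (Lan-factor M γ) ⟦ i ⟧ᵢ) (s-generator i x))
              (Functor.identity M (to (η γ i) x))
          ; factor-unique = λ M γ σ p A x → Setoid.trans (F₀ M A)
              (cong (η σ A) (Setoid.sym (F.F₀ A) (recompose-s A x)))
              (through M γ σ p A (to (η s A) x))
          }
        }
        where
          s-generator : ∀ i x → F₀ Lan ⟦ i ⟧ᵢ [ to (η s ⟦ i ⟧ᵢ) x ≈ ⟨ i , x , idₛ ⟩ ]
          s-generator i x = aux (to (η s ⟦ i ⟧ᵢ) x) (recompose-s ⟦ i ⟧ᵢ x)
            where
              aux : (w : ∣ F₀ Lan ⟦ i ⟧ᵢ ∣) → F.F₀ ⟦ i ⟧ᵢ [ to (η recompose ⟦ i ⟧ᵢ) w ≈ x ] →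
                    F₀ Lan ⟦ i ⟧ᵢ [ w ≈ ⟨ i , x , idₛ ⟩ ]
              aux ⟨ j , y , k ⟩ p = step (k , tt) p (λ _ → Setoid.refl ⟦ i ⟧ᵢ)

          fac : (M : Endofunctor ℓ) →
                NaturalTransformation restriction (M ∘F SmallSubcategory.inclusion full) →
                NaturalTransformation F M
          fac M γ = record
            { η = λ A → η (Lan-factor M γ) A ⊙ η s A
            ; commute = λ {A} {B} f x → Setoid.trans (F₀ M B)
                (cong (η (Lan-factor M γ) B) (commute s f x))
                (commute (Lan-factor M γ) f (to (η s A) x)) }

          through : ∀ M γ (σ : NaturalTransformation F M) →
                    (∀ i x → F₀ M ⟦ i ⟧ᵢ [ to (η σ ⟦ i ⟧ᵢ) x ≈ to (η γ i) x ]) →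
                    ∀ A w → F₀ M A [ to (η σ A) (to (η recompose A) w)
                                   ≈ to (η (Lan-factor M γ) A) w ]
          through M γ σ p A ⟨ i , x , k ⟩ = Setoid.trans (F₀ M A)
            (commute σ k x) (cong (F₁ M k) (p i x))

idEndo : Endofunctor ℓ
idEndo = record
  { F₀ = λ A → A
  ; F₁ = λ f → f
  ; identity = λ {A} _ → Setoid.refl A
  ; homomorphism = λ {_} {_} {C} _ → Setoid.refl C
  ; F-resp-≈ = λ p → p
  }

𝟙 : Setoid ℓ ℓ
𝟙 = record { Carrier = ⊤ ; _≈_ = λ _ _ → ⊤
           ; isEquivalence = record { refl = tt ; sym = λ _ → tt ; trans = λ _ _ → tt } }

Id : SmallFunctor ℓ
Id {ℓ} = idEndo , isSmall s (λ A _ → Setoid.refl A)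
  where
    open Criterion {I = ⊤} (λ _ → 𝟙) (idEndo {ℓ})

    s : NaturalTransformation idEndo Lan
    s = record
      { η = λ A → record
        { to = λ x → ⟨ tt , tt , record { to = λ _ → x ; cong = λ _ → Setoid.refl A } ⟩
        ; cong = λ p → ∼-≈ restriction (power∘J A) tt (λ _ → p) }
      ; commute = λ {_} {B} f x → ∼-≈ restriction (power∘J B) tt (λ _ → Setoid.refl B)
      }

infixr 6 _⊎F_
_⊎F_ : Endofunctor ℓ → Endofunctor ℓ → Endofunctor ℓ
F ⊎F G = record
  { F₀ = λ A → F.F₀ A ⊎ₛ G.F₀ A
  ; F₁ = λ f → record
    { to = λ { (inj₁ x) → inj₁ (to (F.F₁ f) x) ; (inj₂ y) → inj₂ (to (G.F₁ f) y) }
    ; cong = λ { (inj₁ p) → inj₁ (cong (F.F₁ f) p) ; (inj₂ q) → inj₂ (cong (G.F₁ f) q) } }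
  ; identity = λ { (inj₁ x) → inj₁ (F.identity x) ; (inj₂ y) → inj₂ (G.identity y) }
  ; homomorphism = λ { (inj₁ x) → inj₁ (F.homomorphism x)
                     ; (inj₂ y) → inj₂ (G.homomorphism y) }
  ; F-resp-≈ = λ { p (inj₁ x) → inj₁ (F.F-resp-≈ p x)
                 ; p (inj₂ y) → inj₂ (G.F-resp-≈ p y) }
  }
  where
    module F = Functor F
    module G = Functor G

module _ (F G : SmallFunctor ℓ) where
  private
    module F = Small F
    module G = Small G

    ⟦_⟧⊎ : F.Ob ⊎ G.Ob → Setoid ℓ ℓ
    ⟦ inj₁ a ⟧⊎ = F.⟦ a ⟧
    ⟦ inj₂ b ⟧⊎ = G.⟦ b ⟧

    open Criterion ⟦_⟧⊎ (proj₁ F ⊎F proj₁ G)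

    embed₁ : NaturalTransformation F.Lan Lan
    embed₁ = F.Lan-factor Lan record
      { η = λ a → record
        { to = λ x → ⟨ inj₁ a , inj₁ (to (η F.ι a) x) , idₛ ⟩
        ; cong = λ p → ∼-≈ restriction (power∘J F.⟦ a ⟧) (inj₁ (cong (η F.ι a) p))
                                         (λ _ → Setoid.refl F.⟦ a ⟧) }
      ; commute = λ {a} {b} f x → ∼-sym (step (proj₁ f , tt)
          (inj₁ (Setoid.sym (F.Fun F.⟦ b ⟧) (commute F.ι f x)))
          (λ _ → Setoid.refl F.⟦ b ⟧))
      }

    embed₂ : NaturalTransformation G.Lan Lan
    embed₂ = G.Lan-factor Lan record
      { η = λ a → record
        { to = λ x → ⟨ inj₂ a , inj₂ (to (η G.ι a) x) , idₛ ⟩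
        ; cong = λ p → ∼-≈ restriction (power∘J G.⟦ a ⟧) (inj₂ (cong (η G.ι a) p))
                                         (λ _ → Setoid.refl G.⟦ a ⟧) }
      ; commute = λ {a} {b} f x → ∼-sym (step (proj₁ f , tt)
          (inj₂ (Setoid.sym (G.Fun G.⟦ b ⟧) (commute G.ι f x)))
          (λ _ → Setoid.refl G.⟦ b ⟧))
      }

    s : NaturalTransformation (proj₁ F ⊎F proj₁ G) Lan
    s = record
      { η = λ A → record
        { to = λ { (inj₁ x) → to (η embed₁ A) (to (η F.decompose A) x)
                 ; (inj₂ y) → to (η embed₂ A) (to (η G.decompose A) y) }
        ; cong = λ { (inj₁ p) → cong (η embed₁ A) (cong (η F.decompose A) p)
                   ; (inj₂ q) → cong (η embed₂ A) (cong (η G.decompose A) q) } }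
      ; commute = λ { {A} {B} f (inj₁ x) → Setoid.trans (F₀ Lan B)
                        (cong (η embed₁ B) (commute F.decompose f x))
                        (commute embed₁ f (to (η F.decompose A) x))
                    ; {A} {B} f (inj₂ y) → Setoid.trans (F₀ Lan B)
                        (cong (η embed₂ B) (commute G.decompose f y))
                        (commute embed₂ f (to (η G.decompose A) y)) }
      }

  infixr 6 _⊕_
  _⊕_ : SmallFunctor ℓ
  _⊕_ = proj₁ F ⊎F proj₁ G , isSmall s
    (λ { A (inj₁ x) → inj₁ (F.compose∘decompose A x)
       ; A (inj₂ y) → inj₂ (G.compose∘decompose A y) })

SmallEndo-coproducts : BinaryCoproducts (SmallEndo ℓ)
SmallEndo-coproducts = record
  { _+_ = _⊕_
  ; i₁ = λ {F} {G} → record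
    { η = λ A → record { to = inj₁ ; cong = inj₁ }
    ; commute = λ {_} {B} _ _ → inj₁ (Setoid.refl (F₀ (proj₁ F) B)) }
  ; i₂ = λ {F} {G} → record
    { η = λ A → record { to = inj₂ ; cong = inj₂ }
    ; commute = λ {_} {B} _ _ → inj₂ (Setoid.refl (F₀ (proj₁ G) B)) }
  ; [_,_] = λ σ τ → record
    { η = λ A → record
      { to = λ { (inj₁ x) → to (η σ A) x ; (inj₂ y) → to (η τ A) y }
      ; cong = λ { (inj₁ p) → cong (η σ A) p ; (inj₂ q) → cong (η τ A) q } }
    ; commute = λ { f (inj₁ x) → commute σ f x ; f (inj₂ y) → commute τ f y } }
  ; inject₁ = λ {_} {_} {X} A _ → Setoid.refl (F₀ (proj₁ X) A)
  ; inject₂ = λ {_} {_} {X} A _ → Setoid.refl (F₀ (proj₁ X) A)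
  ; unique = λ { u p q A (inj₁ x) → p A x ; u p q A (inj₂ y) → q A y }
  }

-- Existence of the Day convolution for small F, as ∫^a base a × G (B^⟦ a ⟧):
-- the coend formula with F replaced by its pointwise Kan extension and D
-- eliminated by the Yoneda lemma.
curryAlong : {A B C D : Setoid ℓ ℓ} → Func (C ×ₛ D) B → Func A C → Func D (A ⇨ B)
curryAlong {A = A} {C = C} {D} h f = record
  { to = λ d → record { to = λ u → to h (to f u , d)
                      ; cong = λ p → cong h (cong f p , Setoid.refl D) }
  ; cong = λ q u → cong h (Setoid.refl C , q) }

evaluate : {A B : Setoid ℓ ℓ} → Func (A ×ₛ (A ⇨ B)) B
evaluate {B = B} = record
  { to = λ (u , k) → to k u
  ; cong = λ {(_ , k)} {(u′ , _)} (p , q) → Setoid.trans B (cong k p) (q u′) }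

module _ (F : SmallFunctor ℓ) (G : Endofunctor ℓ) where
  private
    module F = Small F
    module G = Functor G

    Q : Setoid ℓ ℓ → Functor (Op F.category) (SET ℓ)
    Q B = G ∘F′ F.power∘J B
      where
        _∘F′_ : {C : Category ℓ ℓ ℓ} → Endofunctor ℓ → Functor C (SET ℓ) → Functor C (SET ℓ)
        _∘F′_ = _∘F_

    Q-map : ∀ {A B} → Func A B → NaturalTransformation (Q A) (Q B)
    Q-map {A} {B} k = record
      { η = λ a → G.F₁ (η (F.power∘J-map k) a)
      ; commute = λ {a} {b} f y → let open Setoid (G.F₀ (F.⟦ b ⟧ ⇨ B)) in
          trans (sym (G.homomorphism y))
          (trans (G.F-resp-≈ (commute (F.power∘J-map k) f) y) (G.homomorphism y))
      }

  dayFunctor : Endofunctor ℓ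
  dayFunctor = record
    { F₀ = λ B → F.base ⊠ Q B
    ; F₁ = λ k → ⊠-map F.base (Q-map k)
    ; identity = λ {A} w → ∼-≈ F.base (Q A) (Setoid.refl (F₀ F.base (Element.index w)))
        (G.identity (Element.right w))
    ; homomorphism = λ {_} {_} {C} w → ∼-≈ F.base (Q C) (Setoid.refl (F₀ F.base (Element.index w)))
        (G.homomorphism (Element.right w))
    ; F-resp-≈ = λ {_} {B} p w → ∼-≈ F.base (Q B) (Setoid.refl (F₀ F.base (Element.index w)))
        (G.F-resp-≈ (λ k u → p (to k u)) (Element.right w))
    }

  private
    -- the class of (e , y , h), where x = compose e ∈ F C
    class : ∀ {B C D} → ∣ G.F₀ D ∣ → Func (C ×ₛ D) B → Func (F₀ F.Lan C) (F₀ dayFunctor B)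
    class {B} {C} {D} y h = ⊠-elim F.base (F.power∘J C)
      (λ a x f → ⟨ a , x , to (G.F₁ (curryAlong h f)) y ⟩)
      (λ {a} {b} f p q → step f p
        (Setoid.trans (G.F₀ (F.⟦ a ⟧ ⇨ B))
          (G.F-resp-≈ (λ d u → cong h (q u , Setoid.refl D)) y)
          (G.homomorphism y)))

    class-cong : ∀ {B C D} {y y′ : ∣ G.F₀ D ∣} {h h′ : Func (C ×ₛ D) B} →
                 G.F₀ D [ y ≈ y′ ] → ((C ×ₛ D) ⇨ B) [ h ≈ h′ ] →
                 ∀ w → F₀ dayFunctor B [ to (class y h) w ≈ to (class y′ h′) w ]
    class-cong {B} {y′ = y′} {h} p q ⟨ a , x , f ⟩ = ∼-≈ F.base (Q B)
      (Setoid.refl (F₀ F.base a))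
      (Setoid.trans (G.F₀ (F.⟦ a ⟧ ⇨ B)) (cong (G.F₁ (curryAlong h f)) p)
        (G.F-resp-≈ (λ d u → q (to f u , d)) y′))

    class-dinatural : ∀ {B C C′ D D′} (f : Func C C′) (g : Func D D′) (y : ∣ G.F₀ D ∣)
      (h : Func (C′ ×ₛ D′) B) (w : ∣ F₀ F.Lan C ∣) →
      F₀ dayFunctor B [ to (class y (h ⊙ (f ×₁ g))) w
                      ≈ to (class (to (G.F₁ g) y) h) (to (F₁ F.Lan f) w) ]
    class-dinatural {B} f g y h ⟨ a , x , k ⟩ = ∼-≈ F.base (Q B)
      (Setoid.refl (F₀ F.base a))
      (Setoid.trans (G.F₀ (F.⟦ a ⟧ ⇨ B)) (G.F-resp-≈ (λ _ _ → Setoid.refl B) y)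
                                         (G.homomorphism y))

    inject : ∀ {B} C D → Func ((F.Fun C ×ₛ G.F₀ D) ×ₛ ((C ×ₛ D) ⇨ B)) (F₀ dayFunctor B)
    inject {B} C D = record
      { to = λ ((x , y) , h) → to (class y h) (to (η F.decompose C) x)
      ; cong = λ { {(x , y) , h} {(x′ , y′) , h′} ((p , q) , r) →
          Setoid.trans (F₀ dayFunctor B) (cong (class y h) (cong (η F.decompose C) p))
            (class-cong {h = h} {h′} q r (to (η F.decompose C) x′)) }
      }

    wedge : ∀ B → Cowedge (dayIntegrand (proj₁ F) G B) (F₀ dayFunctor B)
    wedge B = record
      { ψ = λ (C , D) → inject C D
      ; dinatural = λ { {C , D} {C′ , D′} (f , g) ((x , y) , h) →
          let open Setoid (F₀ dayFunctor B) in
          trans (cong (inject C D) {(to (F.fmap idₛ) x , to (G.F₁ idₛ) y) , h ⊙ (f ×₁ g)}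
                                   {(x , y) , h ⊙ (f ×₁ g)}
                  ((F.fmap-id x , G.identity y) , λ _ → Setoid.refl B))
          (trans (class-dinatural f g y h (to (η F.decompose C) x))
          (trans (cong (class (to (G.F₁ g) y) h) (Setoid.sym (F₀ F.Lan C′) (commute F.decompose f x)))
          (class-cong {h = h} {h ⊙ idₛ} (Setoid.refl (G.F₀ D′)) (λ _ → Setoid.refl B)
             (to (η F.decompose C′) (to (F.fmap f) x))))) }
      }

    generator : ∀ {B} a (x : ∣ F₀ F.base a ∣) (q : ∣ G.F₀ (F.⟦ a ⟧ ⇨ B) ∣) →
                F₀ dayFunctor B [ to (inject F.⟦ a ⟧ (F.⟦ a ⟧ ⇨ B)) ((to (η F.ι a) x , q) , evaluate)
                                ≈ ⟨ a , x , q ⟩ ]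
    generator {B} a x q = trans
        (cong (class q evaluate) (F.factor-ι F.Lan F.Lan-ι a x))
        (∼-≈ F.base (Q B) (Setoid.refl (F₀ F.base a))
          (Setoid.trans (G.F₀ (F.⟦ a ⟧ ⇨ B)) (G.F-resp-≈ (λ k u → Setoid.refl B) q) (G.identity q)))
      where open Setoid (F₀ dayFunctor B)

    module _ {B Y : Setoid ℓ ℓ} (v : Cowedge (dayIntegrand (proj₁ F) G B) Y) where
      open Setoid Y
      open Cowedge v

      ψ-cong : ∀ {C D} {x x′ : ∣ F.Fun C ∣} {y y′ : ∣ G.F₀ D ∣} {h h′ : Func (C ×ₛ D) B} →
               F.Fun C [ x ≈ x′ ] → G.F₀ D [ y ≈ y′ ] → ((C ×ₛ D) ⇨ B) [ h ≈ h′ ] →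
               to (ψ (C , D)) ((x , y) , h) ≈ to (ψ (C , D)) ((x′ , y′) , h′)
      ψ-cong {C} {D} {x} {x′} {y} {y′} {h} {h′} p q r =
        cong (ψ (C , D)) {(x , y) , h} {(x′ , y′) , h′} ((p , q) , r)

      slide : ∀ {C D C′ D′} (f : Func C C′) (g : Func D D′) x y h →
              to (ψ (C , D)) ((x , y) , h ⊙ (f ×₁ g)) ≈
              to (ψ (C′ , D′)) ((to (F.fmap f) x , to (G.F₁ g) y) , h)
      slide {C} {D} {C′} {D′} f g x y h =
        trans (ψ-cong (Setoid.sym (F.Fun C) (F.fmap-id x)) (Setoid.sym (G.F₀ D) (G.identity y))
                (λ _ → Setoid.refl B))
        (trans (dinatural (f , g) ((x , y) , h))
        (ψ-cong (Setoid.refl (F.Fun C′)) (Setoid.refl (G.F₀ D′)) (λ _ → Setoid.refl B)))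

      universal′ : Func (F₀ dayFunctor B) Y
      universal′ = ⊠-elim F.base (Q B)
        (λ a x q → to (ψ (F.⟦ a ⟧ , F.⟦ a ⟧ ⇨ B)) ((to (η F.ι a) x , q) , evaluate))
        (λ {a} {b} (f , α) {x} {x′} {q} {q′} p r →
          trans (ψ-cong (Setoid.sym (F.Fun F.⟦ a ⟧) (F.fmap-id (to (η F.ι a) x))) r
                  (λ _ → Setoid.refl B))
          (trans (sym (slide idₛ (F₁ (power B) f) (to (η F.ι a) x) q′ evaluate))
          (trans (ψ-cong (Setoid.refl (F.Fun F.⟦ a ⟧)) (Setoid.refl (G.F₀ (F.⟦ b ⟧ ⇨ B)))
                   (λ _ → Setoid.refl B))
          (trans (slide f idₛ (to (η F.ι a) x) q′ evaluate)
          (ψ-cong (Setoid.trans (F.Fun F.⟦ b ⟧) (Setoid.sym (F.Fun F.⟦ b ⟧) (commute F.ι (f , α) x))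
                                                (cong (η F.ι b) p))
                  (G.identity q′) (λ _ → Setoid.refl B))))))

      universal-class : ∀ {C D} y h (w : ∣ F₀ F.Lan C ∣) →
                        to universal′ (to (class y h) w) ≈
                        to (ψ (C , D)) ((to (η F.compose C) w , y) , h)
      universal-class {C} {D} y h ⟨ a , x , f ⟩ =
        trans (ψ-cong (Setoid.sym (F.Fun F.⟦ a ⟧) (F.fmap-id (to (η F.ι a) x)))
                (Setoid.refl (G.F₀ (F.⟦ a ⟧ ⇨ B))) (λ _ → Setoid.refl B))
        (trans (sym (slide idₛ (curryAlong h f) (to (η F.ι a) x) y evaluate))
        (trans (ψ-cong (Setoid.refl (F.Fun F.⟦ a ⟧)) (Setoid.refl (G.F₀ D)) (λ _ → Setoid.refl B))
        (trans (slide f idₛ (to (η F.ι a) x) y h)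
        (ψ-cong (Setoid.refl (F.Fun C)) (G.identity y) (λ _ → Setoid.refl B)))))

  dayFunctor-isDayConvolution : IsDayConvolution (proj₁ F) G dayFunctor
  dayFunctor-isDayConvolution = record
    { cowedge = wedge
    ; isCoend = λ B → record
      { universal = universal′
      ; universal-β = λ { {Y} v (C , D) ((x , y) , h) → Setoid.trans Y
          (universal-class v y h (to (η F.decompose C) x))
          (ψ-cong v (F.compose∘decompose C x) (Setoid.refl (G.F₀ D)) (λ _ → Setoid.refl B)) }
      ; universal-unique = λ { {Y} v u p ⟨ a , x , q ⟩ → Setoid.trans Y
          (cong u (Setoid.sym (F₀ dayFunctor B) (generator a x q)))
          (p (F.⟦ a ⟧ , F.⟦ a ⟧ ⇨ B) ((to (η F.ι a) x , q) , evaluate)) }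
      }
    ; action = λ {A} {B} k C D x y u → act k y u (to (η F.decompose C) x)
    }
    where
      act : ∀ {A B C D} (k : Func A B) y (u : Func (C ×ₛ D) A) (w : ∣ F₀ F.Lan C ∣) →
            F₀ dayFunctor B [ to (F₁ dayFunctor k) (to (class y u) w) ≈ to (class y (k ⊙ u)) w ]
      act {B = B} k y u ⟨ a , x , f ⟩ = ∼-≈ F.base (Q B) (Setoid.refl (F₀ F.base a))
        (Setoid.trans (G.F₀ (F.⟦ a ⟧ ⇨ B)) (Setoid.sym (G.F₀ (F.⟦ a ⟧ ⇨ B)) (G.homomorphism y))
                                           (G.F-resp-≈ (λ _ _ → Setoid.refl B) y))

module Day {F G H : Endofunctor ℓ} (d : IsDayConvolution F G H) where
  open IsDayConvolution d
  private
    module F = Functor F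
    module G = Functor G
    module H = Functor H

  inj : ∀ {B C D} → ∣ F.F₀ C ∣ → ∣ G.F₀ D ∣ → Func (C ×ₛ D) B → ∣ H.F₀ B ∣
  inj {B} {C} {D} x y h = to (Cowedge.ψ (cowedge B) (C , D)) ((x , y) , h)

  inj-cong : ∀ {B C D x x′ y y′} {h h′ : Func (C ×ₛ D) B} →
             F.F₀ C [ x ≈ x′ ] → G.F₀ D [ y ≈ y′ ] → ((C ×ₛ D) ⇨ B) [ h ≈ h′ ] →
             H.F₀ B [ inj x y h ≈ inj x′ y′ h′ ]
  inj-cong {B} {C} {D} {x} {x′} {y} {y′} {h} {h′} p q r =
    cong (Cowedge.ψ (cowedge B) (C , D)) {(x , y) , h} {(x′ , y′) , h′} ((p , q) , r)

  inj-resp : ∀ {B C D x y} {h h′ : Func (C ×ₛ D) B} → ((C ×ₛ D) ⇨ B) [ h ≈ h′ ] →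
             H.F₀ B [ inj x y h ≈ inj x y h′ ]
  inj-resp {_} {C} {D} {_} {_} {h} {h′} =
    inj-cong {h = h} {h′} (Setoid.refl (F.F₀ C)) (Setoid.refl (G.F₀ D))

  inj-action : ∀ {A B C D} (k : Func A B) x y (h : Func (C ×ₛ D) A) →
               H.F₀ B [ to (H.F₁ k) (inj x y h) ≈ inj x y (k ⊙ h) ]
  inj-action k x y h = action k _ _ x y h

  inj-slide : ∀ {B C C′ D D′} (f : Func C C′) (g : Func D D′) x y (h : Func (C′ ×ₛ D′) B) →
              H.F₀ B [ inj x y (h ⊙ (f ×₁ g)) ≈ inj (to (F.F₁ f) x) (to (G.F₁ g) y) h ]
  inj-slide {B} {C} {C′} {D} {D′} f g x y h = trans
      (inj-cong {h = h ⊙ (f ×₁ g)} {h ⊙ (f ×₁ g)} (Setoid.sym (F.F₀ C) (F.identity x))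
        (Setoid.sym (G.F₀ D) (G.identity y)) (λ _ → Setoid.refl B))
      (trans (Cowedge.dinatural (cowedge B) (f , g) ((x , y) , h))
      (inj-resp {h = h ⊙ (idₛ ×₁ idₛ)} {h} (λ _ → Setoid.refl B)))
    where open Setoid (H.F₀ B)

  inj-move : ∀ {B C C′ D D′} {f : Func C C′} {g : Func D D′} {x x′ y y′}
             {h : Func (C ×ₛ D) B} {k : Func (C′ ×ₛ D′) B} →
             F.F₀ C′ [ to (F.F₁ f) x ≈ x′ ] → G.F₀ D′ [ to (G.F₁ g) y ≈ y′ ] →
             ((C ×ₛ D) ⇨ B) [ k ⊙ (f ×₁ g) ≈ h ] →
             H.F₀ B [ inj x′ y′ k ≈ inj x y h ]
  inj-move {B} {f = f} {g} {x} {x′} {y} {y′} {h} {k} p q r = trans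
      (inj-cong {h = k} {k} (Setoid.sym (F.F₀ _) p) (Setoid.sym (G.F₀ _) q) (λ _ → Setoid.refl B))
      (trans (sym (inj-slide f g x y k)) (inj-resp {h = k ⊙ (f ×₁ g)} {h} r))
    where open Setoid (H.F₀ B)

  inj-id : ∀ {B C D x y} (h : Func (C ×ₛ D) B) →
           H.F₀ B [ to (H.F₁ h) (inj x y idₛ) ≈ inj x y h ]
  inj-id {B} {x = x} {y} h = Setoid.trans (H.F₀ B) (inj-action h x y idₛ)
    (inj-resp {h = h ⊙ idₛ} {h} (λ _ → Setoid.refl B))

  injˡ : ∀ {B C D} → ∣ G.F₀ D ∣ → Func (C ×ₛ D) B → Func (F.F₀ C) (H.F₀ B)
  injˡ {B} {C} {D} y h = record
    { to = λ x → inj x y h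
    ; cong = λ p → inj-cong {h = h} {h} p (Setoid.refl (G.F₀ D)) (λ _ → Setoid.refl B) }

  injʳ : ∀ {B C D} → ∣ F.F₀ C ∣ → Func (C ×ₛ D) B → Func (G.F₀ D) (H.F₀ B)
  injʳ {B} {C} {D} x h = record
    { to = λ y → inj x y h
    ; cong = λ p → inj-cong {h = h} {h} (Setoid.refl (F.F₀ C)) p (λ _ → Setoid.refl B) }

  record Family (B Y : Setoid ℓ ℓ) : Set (suc ℓ) where
    field
      at    : ∀ {C D} → ∣ F.F₀ C ∣ → ∣ G.F₀ D ∣ → Func (C ×ₛ D) B → ∣ Y ∣
      at-cong : ∀ {C D x x′ y y′} {h h′ : Func (C ×ₛ D) B} →
                F.F₀ C [ x ≈ x′ ] → G.F₀ D [ y ≈ y′ ] → ((C ×ₛ D) ⇨ B) [ h ≈ h′ ] →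
                Y [ at x y h ≈ at x′ y′ h′ ]
      at-slide : ∀ {C C′ D D′} (f : Func C C′) (g : Func D D′) x y (h : Func (C′ ×ₛ D′) B) →
                 Y [ at x y (h ⊙ (f ×₁ g)) ≈ at (to (F.F₁ f) x) (to (G.F₁ g) y) h ]

  module _ {B Y : Setoid ℓ ℓ} (t : Family B Y) where
    open Family t
    private
      v : Cowedge (dayIntegrand F G B) Y
      v = record
        { ψ = λ (C , D) → record
          { to = λ ((x , y) , h) → at x y h
          ; cong = λ { {(x , y) , h} {(x′ , y′) , h′} ((p , q) , r) → at-cong {h = h} {h′} p q r } }
        ; dinatural = λ { {C , D} {C′ , D′} (f , g) ((x , y) , h) → let open Setoid Y in
            trans (at-cong {h = h ⊙ (f ×₁ g)} {h ⊙ (f ×₁ g)} (F.identity x) (G.identity y)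
                    (λ _ → Setoid.refl B))
            (trans (at-slide f g x y h)
            (at-cong {h = h} {h ⊙ (idₛ ×₁ idₛ)} (Setoid.refl (F.F₀ C′)) (Setoid.refl (G.F₀ D′))
              (λ _ → Setoid.refl B))) }
        }

    elim : Func (H.F₀ B) Y
    elim = IsCoend.universal (isCoend B) v

    elim-β : ∀ {C D} x y (h : Func (C ×ₛ D) B) → Y [ to elim (inj x y h) ≈ at x y h ]
    elim-β {C} {D} x y h = IsCoend.universal-β (isCoend B) v (C , D) ((x , y) , h)

  ext : ∀ {B Y} (p q : Func (H.F₀ B) Y) →
        (∀ {C D} x y (h : Func (C ×ₛ D) B) → Y [ to p (inj x y h) ≈ to q (inj x y h) ]) →
        ∀ w → Y [ to p w ≈ to q w ]
  ext {B} {Y} p q agree w = trans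
      (IsCoend.universal-unique (isCoend B) v p (λ _ ((x , y) , h) → agree x y h) w)
      (sym (IsCoend.universal-unique (isCoend B) v q (λ _ _ → refl) w))
    where
      open Setoid Y
      v : Cowedge (dayIntegrand F G B) Y
      v = record
        { ψ = λ A → q ⊙ Cowedge.ψ (cowedge B) A
        ; dinatural = λ f z → cong q (Cowedge.dinatural (cowedge B) f z) }

  -- Natural transformations out of H are natural families F C × G D → K (C × D).
  record Bilinear (K : Endofunctor ℓ) : Set (suc ℓ) where
    field
      on : ∀ {C D} → ∣ F.F₀ C ∣ → ∣ G.F₀ D ∣ → ∣ F₀ K (C ×ₛ D) ∣
      on-cong : ∀ {C D x x′ y y′} → F.F₀ C [ x ≈ x′ ] → G.F₀ D [ y ≈ y′ ] →
                F₀ K (C ×ₛ D) [ on x y ≈ on x′ y′ ]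
      on-natural : ∀ {C C′ D D′} (f : Func C C′) (g : Func D D′) x y →
                   F₀ K (C′ ×ₛ D′) [ on (to (F.F₁ f) x) (to (G.F₁ g) y)
                                   ≈ to (F₁ K (f ×₁ g)) (on x y) ]

  module _ {K : Endofunctor ℓ} (t : Bilinear K) where
    open Bilinear t
    private
      module K = Functor K

      family : ∀ B → Family B (K.F₀ B)
      family B = record
        { at = λ x y h → to (K.F₁ h) (on x y)
        ; at-cong = λ { {h′ = h′} p q r →
            Setoid.trans (K.F₀ B) (K.F-resp-≈ r _) (cong (K.F₁ h′) (on-cong p q)) }
        ; at-slide = λ {_} {C′} {_} {D′} f g x y h →
            Setoid.trans (K.F₀ B) (K.homomorphism (on x y))
              (cong (K.F₁ h) (Setoid.sym (K.F₀ (C′ ×ₛ D′)) (on-natural f g x y)))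
        }

    out-β : ∀ {B C D} x y (h : Func (C ×ₛ D) B) →
            K.F₀ B [ to (elim (family B)) (inj x y h) ≈ to (K.F₁ h) (on x y) ]
    out-β {B} = elim-β (family B)

    out : NaturalTransformation H K
    out = record
      { η = λ B → elim (family B)
      ; commute = λ {A} {B} k → ext (elim (family B) ⊙ H.F₁ k) (K.F₁ k ⊙ elim (family A))
          (λ x y h → let open Setoid (K.F₀ B) in
            trans (cong (elim (family B)) (inj-action k x y h))
            (trans (out-β x y (k ⊙ h))
            (trans (K.homomorphism (on x y))
            (sym (cong (K.F₁ k) (out-β x y h))))))
      }

  -- It suffices to compare natural transformations on inj x y id.
  out-ext : {K : Endofunctor ℓ} (σ τ : NaturalTransformation H K) →
            (∀ {C D} x y → F₀ K (C ×ₛ D) [ to (η σ _) (inj x y (idₛ {A = C ×ₛ D}))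
                                          ≈ to (η τ _) (inj x y idₛ) ]) →
            ∀ B w → F₀ K B [ to (η σ B) w ≈ to (η τ B) w ]
  out-ext {K} σ τ agree B = ext (η σ B) (η τ B) (λ x y h → let open Setoid (F₀ K B) in
    trans (reduce σ x y h)
    (trans (cong (F₁ K h) (agree x y)) (sym (reduce τ x y h))))
    where
      reduce : (σ : NaturalTransformation H K) → ∀ {C D} x y (h : Func (C ×ₛ D) B) →
               F₀ K B [ to (η σ B) (inj x y h) ≈ to (F₁ K h) (to (η σ (C ×ₛ D)) (inj x y idₛ)) ]
      reduce σ x y h = Setoid.trans (F₀ K B)
        (cong (η σ B) (Setoid.trans (H.F₀ B) (inj-resp {h = h} {h ⊙ idₛ} (λ _ → Setoid.refl B))
                                             (Setoid.sym (H.F₀ B) (inj-action h x y idₛ))))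
        (commute σ h (inj x y idₛ))

module _ (F G : SmallFunctor ℓ) {H : Endofunctor ℓ}
         (d : IsDayConvolution (proj₁ F) (proj₁ G) H) where
  private
    module F = Small F
    module G = Small G
    module H = Functor H
    open Day d

    ⟦_⟧× : F.Ob × G.Ob → Setoid ℓ ℓ
    ⟦ a , b ⟧× = F.⟦ a ⟧ ×ₛ G.⟦ b ⟧

    open Criterion ⟦_⟧× H

    combine : ∀ {B C D} → Func (C ×ₛ D) B → ∣ F₀ F.Lan C ∣ → ∣ F₀ G.Lan D ∣ → ∣ F₀ Lan B ∣
    combine h ⟨ a , x , f ⟩ ⟨ b , y , g ⟩ =
      ⟨ (a , b) , inj (to (η F.ι a) x) (to (η G.ι b) y) idₛ , h ⊙ (f ×₁ g) ⟩

    combine-step : ∀ {B C D} (h : Func (C ×ₛ D) B) {a a′ b b′}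
                   ((f , _) : Category._⇒_ F.category a a′)
                   ((g , _) : Category._⇒_ G.category b b′) {x x′ y y′}
                   {k : Func F.⟦ a ⟧ C} {k′ : Func F.⟦ a′ ⟧ C}
                   {l : Func G.⟦ b ⟧ D} {l′ : Func G.⟦ b′ ⟧ D} →
                   F.Fun F.⟦ a′ ⟧ [ to (F.fmap f) (to (η F.ι a) x) ≈ to (η F.ι a′) x′ ] →
                   G.Fun G.⟦ b′ ⟧ [ to (G.fmap g) (to (η G.ι b) y) ≈ to (η G.ι b′) y′ ] →
                   (F.⟦ a ⟧ ⇨ C) [ k ≈ k′ ⊙ f ] → (G.⟦ b ⟧ ⇨ D) [ l ≈ l′ ⊙ g ] →
                   F₀ Lan B [ combine h ⟨ a , x , k ⟩ ⟨ b , y , l ⟩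
                            ≈ combine h ⟨ a′ , x′ , k′ ⟩ ⟨ b′ , y′ , l′ ⟩ ]
    combine-step h {a} {a′} {b} {b′} (f , _) (g , _) {x} {x′} {y} {y′} p q r s =
      step (f ×₁ g , tt)
        (trans (inj-action (f ×₁ g) (to (η F.ι a) x) (to (η G.ι b) y) idₛ)
        (trans (inj-resp {h = (f ×₁ g) ⊙ idₛ} {idₛ ⊙ (f ×₁ g)}
                 (λ _ → Setoid.refl ⟦ a′ , b′ ⟧×))
        (trans (inj-slide f g (to (η F.ι a) x) (to (η G.ι b) y) idₛ)
        (inj-cong {h = idₛ} {idₛ} p q (λ _ → Setoid.refl ⟦ a′ , b′ ⟧×)))))
        (λ (u , v) → cong h (r u , s v))
      where open Setoid (H.F₀ ⟦ a′ , b′ ⟧×)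

    combineˡ : ∀ {B C D} → Func (C ×ₛ D) B → ∣ F₀ G.Lan D ∣ → Func (F₀ F.Lan C) (F₀ Lan B)
    combineˡ {C = C} {D} h v@(⟨ b , y , l ⟩) = ⊠-elim F.base (F.power∘J C) (λ a x k → combine h ⟨ a , x , k ⟩ v)
      (λ f p r → combine-step h f (Category.id G.category {b}) (F.ι-arrow f p)
        (G.fmap-id (to (η G.ι b) y)) r (λ _ → Setoid.refl D))

    combineʳ : ∀ {B C D} → Func (C ×ₛ D) B → ∣ F₀ F.Lan C ∣ → Func (F₀ G.Lan D) (F₀ Lan B)
    combineʳ {C = C} {D} h w@(⟨ a , x , k ⟩) = ⊠-elim G.base (G.power∘J D) (λ b y l → combine h w ⟨ b , y , l ⟩)
      (λ g q s → combine-step h (Category.id F.category {a}) g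
        (F.fmap-id (to (η F.ι a) x)) (G.ι-arrow g q) (λ _ → Setoid.refl C) s)

    combine-cong : ∀ {B C D} {h h′ : Func (C ×ₛ D) B} {w w′ v v′} →
                   ((C ×ₛ D) ⇨ B) [ h ≈ h′ ] → F₀ F.Lan C [ w ≈ w′ ] → F₀ G.Lan D [ v ≈ v′ ] →
                   F₀ Lan B [ combine h w v ≈ combine h′ w′ v′ ]
    combine-cong {B} {h = h} {h′} {w} {w′} {v} {v′} p q r =
      trans (cong (combineˡ h v) q) (trans (cong (combineʳ h w′) r)
        (∼-≈ restriction (power∘J B) (Setoid.refl (H.F₀ ⟦ Element.index w′ , Element.index v′ ⟧×))
          (λ (c , d) → p (to (Element.right w′) c , to (Element.right v′) d))))
      where open Setoid (F₀ Lan B)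

    s-family : ∀ B → Family B (F₀ Lan B)
    s-family B = record
      { at = λ {C} {D} x y h → combine h (to (η F.decompose C) x) (to (η G.decompose D) y)
      ; at-cong = λ {C} {D} {h = h} {h′} p q r →
          combine-cong {h = h} {h′} r (cong (η F.decompose C) p) (cong (η G.decompose D) q)
      ; at-slide = λ {C} {C′} {D} {D′} f g x y h → combine-cong {h = h} {h} (λ _ → Setoid.refl B)
          (Setoid.sym (F₀ F.Lan C′) (commute F.decompose f x))
          (Setoid.sym (F₀ G.Lan D′) (commute G.decompose g y))
      }

    s-component : ∀ B → Func (H.F₀ B) (F₀ Lan B)
    s-component B = elim (s-family B)

    s-β : ∀ {B C D} x y (h : Func (C ×ₛ D) B) →
          F₀ Lan B [ to (s-component B) (inj x y h)
                   ≈ combine h (to (η F.decompose C) x) (to (η G.decompose D) y) ]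
    s-β {B} = elim-β (s-family B)

    s : NaturalTransformation H Lan
    s = record
      { η = s-component
      ; commute = λ {A} {B} k → ext (s-component B ⊙ H.F₁ k) (F₁ Lan k ⊙ s-component A)
          (λ x y h → let open Setoid (F₀ Lan B) in
            trans (cong (s-component B) (inj-action k x y h))
            (trans (s-β x y (k ⊙ h))
            (sym (cong (F₁ Lan k) (s-β x y h)))))
      }

    recompose-combine : ∀ {B C D} (h : Func (C ×ₛ D) B) w v →
      H.F₀ B [ to (η recompose B) (combine h w v)
             ≈ inj (to (η F.compose C) w) (to (η G.compose D) v) h ]
    recompose-combine {B} h ⟨ a , x , k ⟩ ⟨ b , y , l ⟩ =
      trans (inj-action (h ⊙ (k ×₁ l)) (to (η F.ι a) x) (to (η G.ι b) y) idₛ)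
      (trans (inj-resp {h = (h ⊙ (k ×₁ l)) ⊙ idₛ} {h ⊙ (k ×₁ l)} (λ _ → Setoid.refl B))
      (inj-slide k l (to (η F.ι a) x) (to (η G.ι b) y) h))
      where open Setoid (H.F₀ B)

  day-isSmall : IsSmall H
  day-isSmall = isSmall s (λ B → ext (η recompose B ⊙ s-component B) idₛ
    (λ {C} {D} x y h → let open Setoid (H.F₀ B) in
      trans (cong (η recompose B) (s-β x y h))
      (trans (recompose-combine h (to (η F.decompose C) x) (to (η G.decompose D) y))
      (inj-cong {h = h} {h} (F.compose∘decompose C x) (G.compose∘decompose D y)
        (λ _ → Setoid.refl B)))))

-- Only the universal property of F ⋆ G matters from here on.
infixr 7 _⋆_
opaque
  _⋆_ : SmallFunctor ℓ → SmallFunctor ℓ → SmallFunctor ℓ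
  F ⋆ G = dayFunctor F (proj₁ G) , day-isSmall F G (dayFunctor-isDayConvolution F (proj₁ G))

  ⋆-isDayConvolution : (F G : SmallFunctor ℓ) →
                       IsDayConvolution (proj₁ F) (proj₁ G) (proj₁ (F ⋆ G))
  ⋆-isDayConvolution F G = dayFunctor-isDayConvolution F (proj₁ G)

module ⋆ (F G : SmallFunctor ℓ) where
  open Day (⋆-isDayConvolution F G) public
  module F = Functor (proj₁ F)
  module G = Functor (proj₁ G)

  Fun : Setoid ℓ ℓ → Setoid ℓ ℓ
  Fun = F₀ (proj₁ (F ⋆ G))

module ⋆³ (F G H : SmallFunctor ℓ) where
  module F = Functor (proj₁ F)
  module G = Functor (proj₁ G)
  module H = Functor (proj₁ H)
  module FG = ⋆ F G
  module GH = ⋆ G H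
  module L = ⋆ (F ⋆ G) H
  module R = ⋆ F (G ⋆ H)

  extˡ : ∀ {B Y} (p q : Func (L.Fun B) Y) →
         (∀ {C D C′ D′} (x : ∣ F.F₀ C ∣) (y : ∣ G.F₀ D ∣) (h : Func (C ×ₛ D) C′)
            (z : ∣ H.F₀ D′ ∣) (k : Func (C′ ×ₛ D′) B) →
            Y [ to p (L.inj (FG.inj x y h) z k) ≈ to q (L.inj (FG.inj x y h) z k) ]) →
         ∀ w → Y [ to p w ≈ to q w ]
  extˡ p q agree = L.ext p q (λ w z k → FG.ext (p ⊙ L.injˡ z k) (q ⊙ L.injˡ z k)
    (λ x y h → agree x y h z k) w)

  extʳ : ∀ {B Y} (p q : Func (R.Fun B) Y) →
         (∀ {C D C′ D′} (x : ∣ F.F₀ C ∣) (y : ∣ G.F₀ D ∣) (z : ∣ H.F₀ D′ ∣)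
            (h : Func (D ×ₛ D′) C′) (k : Func (C ×ₛ C′) B) →
            Y [ to p (R.inj x (GH.inj y z h) k) ≈ to q (R.inj x (GH.inj y z h) k) ]) →
         ∀ w → Y [ to p w ≈ to q w ]
  extʳ p q agree = R.ext p q (λ x w k → GH.ext (p ⊙ R.injʳ x k) (q ⊙ R.injʳ x k)
    (λ y z h → agree x y z h k) w)

  moveˡ : ∀ {A A′ B B′ C C′ D E} {f : Func A A′} {g : Func B B′} {j : Func C C′} {x x′ y y′ z z′}
          {m : Func (A′ ×ₛ B′) D} {n : Func (D ×ₛ C′) E} {h : Func ((A ×ₛ B) ×ₛ C) E} →
          F.F₀ A′ [ to (F.F₁ f) x ≈ x′ ] → G.F₀ B′ [ to (G.F₁ g) y ≈ y′ ] →
          H.F₀ C′ [ to (H.F₁ j) z ≈ z′ ] →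
          (((A ×ₛ B) ×ₛ C) ⇨ E) [ n ⊙ ((m ⊙ (f ×₁ g)) ×₁ j) ≈ h ] →
          L.Fun E [ L.inj (FG.inj x′ y′ m) z′ n ≈ L.inj (FG.inj x y idₛ) z h ]
  moveˡ {D = D} {f = f} {g} {j} {m = m} {n} {h} p q r s = L.inj-move {f = m ⊙ (f ×₁ g)} {j} {h = h} {n}
    (Setoid.trans (FG.Fun D) (FG.inj-id (m ⊙ (f ×₁ g)))
      (Setoid.sym (FG.Fun D) (FG.inj-move {f = f} {g} {h = m ⊙ (f ×₁ g)} {m} p q (λ _ → Setoid.refl D))))
    r s

  moveʳ : ∀ {A A′ B B′ C C′ D E} {f : Func A A′} {g : Func B B′} {j : Func C C′} {x x′ y y′ z z′}
          {m : Func (B′ ×ₛ C′) D} {n : Func (A′ ×ₛ D) E} {h : Func (A ×ₛ (B ×ₛ C)) E} →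
          F.F₀ A′ [ to (F.F₁ f) x ≈ x′ ] → G.F₀ B′ [ to (G.F₁ g) y ≈ y′ ] →
          H.F₀ C′ [ to (H.F₁ j) z ≈ z′ ] →
          ((A ×ₛ (B ×ₛ C)) ⇨ E) [ n ⊙ (f ×₁ (m ⊙ (g ×₁ j))) ≈ h ] →
          R.Fun E [ R.inj x′ (GH.inj y′ z′ m) n ≈ R.inj x (GH.inj y z idₛ) h ]
  moveʳ {D = D} {f = f} {g} {j} {m = m} {n} {h} p q r s = R.inj-move {f = f} {m ⊙ (g ×₁ j)} {h = h} {n}
    p
    (Setoid.trans (GH.Fun D) (GH.inj-id (m ⊙ (g ×₁ j)))
      (Setoid.sym (GH.Fun D) (GH.inj-move {f = g} {j} {h = m ⊙ (g ×₁ j)} {m} q r (λ _ → Setoid.refl D))))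
    s

assocʳ : {A B C : Setoid ℓ ℓ} → Func (A ×ₛ (B ×ₛ C)) ((A ×ₛ B) ×ₛ C)
assocʳ = record { to = λ (a , (b , c)) → (a , b) , c
                ; cong = λ (p , (q , r)) → (p , q) , r }

assocˡ : {A B C : Setoid ℓ ℓ} → Func ((A ×ₛ B) ×ₛ C) (A ×ₛ (B ×ₛ C))
assocˡ = record { to = λ ((a , b) , c) → a , (b , c)
                ; cong = λ ((p , q) , r) → p , (q , r) }

pairˡ : {A B C : Setoid ℓ ℓ} → Func (A ×ₛ B) C → ∣ A ∣ → Func B C
pairˡ {A = A} h a = record { to = λ b → to h (a , b) ; cong = λ p → cong h (Setoid.refl A , p) }

pairʳ : {A B C : Setoid ℓ ℓ} → Func (A ×ₛ B) C → ∣ B ∣ → Func A C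
pairʳ {B = B} h b = record { to = λ a → to h (a , b) ; cong = λ p → cong h (p , Setoid.refl B) }

module _ (F F′ G G′ : SmallFunctor ℓ) (σ : NaturalTransformation (proj₁ F) (proj₁ F′))
         (τ : NaturalTransformation (proj₁ G) (proj₁ G′)) where
  private
    module S = ⋆ F G
    module T = ⋆ F′ G′

    bilinear : S.Bilinear (proj₁ (F′ ⋆ G′))
    bilinear = record
      { on = λ {C} {D} x y → T.inj (to (η σ C) x) (to (η τ D) y) idₛ
      ; on-cong = λ {C} {D} p q →
          T.inj-cong {h = idₛ} {idₛ} (cong (η σ C) p) (cong (η τ D) q) (λ _ → Setoid.refl (C ×ₛ D))
      ; on-natural = λ {C} {C′} {D} {D′} f g x y → let open Setoid (T.Fun (C′ ×ₛ D′)) in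
          trans (T.inj-move {f = f} {g} {h = f ×₁ g} {idₛ}
                  (Setoid.sym (T.F.F₀ C′) (commute σ f x)) (Setoid.sym (T.G.F₀ D′) (commute τ g y))
                  (λ _ → Setoid.refl (C′ ×ₛ D′)))
          (sym (T.inj-id (f ×₁ g)))
      }

  opaque
    bimap : NaturalTransformation (proj₁ (F ⋆ G)) (proj₁ (F′ ⋆ G′))
    bimap = S.out bilinear

    bimap-β : ∀ {B C D} x y (h : Func (C ×ₛ D) B) →
           T.Fun B [ to (η bimap B) (S.inj x y h) ≈ T.inj (to (η σ C) x) (to (η τ D) y) h ]
    bimap-β {B} x y h = Setoid.trans (T.Fun B) (S.out-β bilinear x y h) (T.inj-id h)

module _ (F : SmallFunctor ℓ) where
  private
    module F = Functor (proj₁ F)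
    module l = ⋆ Id F
    module r = ⋆ F Id

    bilinearˡ : l.Bilinear (proj₁ F)
    bilinearˡ = record
      { on = λ a x → to (F.F₁ (pairˡ idₛ a)) x
      ; on-cong = λ {C} {D} {a} {a′} {x} {x′} p q → Setoid.trans (F.F₀ (C ×ₛ D))
          (F.F-resp-≈ (λ _ → p , Setoid.refl D) x) (cong (F.F₁ (pairˡ idₛ a′)) q)
      ; on-natural = λ {C} {C′} {D} {D′} f g a x → let open Setoid (F.F₀ (C′ ×ₛ D′)) in
          trans (sym (F.homomorphism x))
          (trans (F.F-resp-≈ (λ _ → Setoid.refl (C′ ×ₛ D′)) x)
          (F.homomorphism x))
      }

    bilinearʳ : r.Bilinear (proj₁ F)
    bilinearʳ = record
      { on = λ x b → to (F.F₁ (pairʳ idₛ b)) x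
      ; on-cong = λ {C} {D} {x} {x′} {b} {b′} p q → Setoid.trans (F.F₀ (C ×ₛ D))
          (F.F-resp-≈ (λ _ → Setoid.refl C , q) x) (cong (F.F₁ (pairʳ idₛ b′)) p)
      ; on-natural = λ {C} {C′} {D} {D′} f g x b → let open Setoid (F.F₀ (C′ ×ₛ D′)) in
          trans (sym (F.homomorphism x))
          (trans (F.F-resp-≈ (λ _ → Setoid.refl (C′ ×ₛ D′)) x)
          (F.homomorphism x))
      }

    π₁ : {B : Setoid ℓ ℓ} → Func (B ×ₛ (𝟙 {ℓ})) B
    π₁ = record { to = proj₁ ; cong = proj₁ }

    π₂ : {B : Setoid ℓ ℓ} → Func ((𝟙 {ℓ}) ×ₛ B) B
    π₂ = record { to = proj₂ ; cong = proj₂ }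

  opaque
    unitorˡ : NaturalTransformation (proj₁ (Id ⋆ F)) (proj₁ F)
    unitorˡ = l.out bilinearˡ

    unitorˡ-β : ∀ {B C D} (a : ∣ C ∣) x (h : Func (C ×ₛ D) B) →
                F.F₀ B [ to (η unitorˡ B) (l.inj a x h) ≈ to (F.F₁ (pairˡ h a)) x ]
    unitorˡ-β {B} a x h = let open Setoid (F.F₀ B) in
      trans (l.out-β bilinearˡ a x h)
      (trans (sym (F.homomorphism x)) (F.F-resp-≈ (λ _ → Setoid.refl B) x))

  opaque
    unitorʳ : NaturalTransformation (proj₁ (F ⋆ Id)) (proj₁ F)
    unitorʳ = r.out bilinearʳ

    unitorʳ-β : ∀ {B C D} x (b : ∣ D ∣) (h : Func (C ×ₛ D) B) →
                F.F₀ B [ to (η unitorʳ B) (r.inj x b h) ≈ to (F.F₁ (pairʳ h b)) x ]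
    unitorʳ-β {B} x b h = let open Setoid (F.F₀ B) in
      trans (r.out-β bilinearʳ x b h)
      (trans (sym (F.homomorphism x)) (F.F-resp-≈ (λ _ → Setoid.refl B) x))

  unitorˡ⁻¹ : NaturalTransformation (proj₁ F) (proj₁ (Id ⋆ F))
  unitorˡ⁻¹ = record
    { η = λ B → l.injʳ tt π₂
    ; commute = λ {A} {B} f x → let open Setoid (l.Fun B) in
        trans (l.inj-move {f = idₛ} {f} {h = f ⊙ π₂} {π₂} tt (Setoid.refl (F.F₀ B)) (λ _ → Setoid.refl B))
        (sym (l.inj-action f tt x π₂))
    }

  unitorʳ⁻¹ : NaturalTransformation (proj₁ F) (proj₁ (F ⋆ Id))
  unitorʳ⁻¹ = record
    { η = λ B → r.injˡ tt π₁
    ; commute = λ {A} {B} f x → let open Setoid (r.Fun B) in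
        trans (r.inj-move {f = f} {idₛ} {h = f ⊙ π₁} {π₁} (Setoid.refl (F.F₀ B)) tt (λ _ → Setoid.refl B))
        (sym (r.inj-action f x tt π₁))
    }

  unitorˡ-isoˡ : ∀ B w → l.Fun B [ to (η unitorˡ⁻¹ B) (to (η unitorˡ B) w) ≈ w ]
  unitorˡ-isoˡ B = l.ext (η unitorˡ⁻¹ B ⊙ η unitorˡ B) idₛ (λ {C} {D} a x h →
    let open Setoid (l.Fun B) in
    trans (cong (η unitorˡ⁻¹ B) (unitorˡ-β a x h))
    (trans (l.inj-move {f = idₛ} {pairˡ h a} {h = h ⊙ (const a ×₁ idₛ)} {π₂}
             tt (Setoid.refl (F.F₀ B)) (λ _ → Setoid.refl B))
    (sym (l.inj-move {f = const a} {idₛ} {h = h ⊙ (const a ×₁ idₛ)} {h}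
             (Setoid.refl C) (F.identity x) (λ _ → Setoid.refl B)))))
    where
      const : ∀ {C : Setoid ℓ ℓ} → ∣ C ∣ → Func 𝟙 C
      const {C} c = record { to = λ _ → c ; cong = λ _ → Setoid.refl C }

  unitorʳ-isoˡ : ∀ B w → r.Fun B [ to (η unitorʳ⁻¹ B) (to (η unitorʳ B) w) ≈ w ]
  unitorʳ-isoˡ B = r.ext (η unitorʳ⁻¹ B ⊙ η unitorʳ B) idₛ (λ {C} {D} x b h →
    let open Setoid (r.Fun B) in
    trans (cong (η unitorʳ⁻¹ B) (unitorʳ-β x b h))
    (trans (r.inj-move {f = pairʳ h b} {idₛ} {h = h ⊙ (idₛ ×₁ const b)} {π₁}
             (Setoid.refl (F.F₀ B)) tt (λ _ → Setoid.refl B))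
    (sym (r.inj-move {f = idₛ} {const b} {h = h ⊙ (idₛ ×₁ const b)} {h}
             (F.identity x) (Setoid.refl D) (λ _ → Setoid.refl B)))))
    where
      const : ∀ {C : Setoid ℓ ℓ} → ∣ C ∣ → Func 𝟙 C
      const {C} c = record { to = λ _ → c ; cong = λ _ → Setoid.refl C }

  unitorˡ-isoʳ : ∀ B x → F.F₀ B [ to (η unitorˡ B) (to (η unitorˡ⁻¹ B) x) ≈ x ]
  unitorˡ-isoʳ B x = let open Setoid (F.F₀ B) in
    trans (unitorˡ-β tt x π₂) (trans (F.F-resp-≈ (λ _ → Setoid.refl B) x) (F.identity x))

  unitorʳ-isoʳ : ∀ B x → F.F₀ B [ to (η unitorʳ B) (to (η unitorʳ⁻¹ B) x) ≈ x ]
  unitorʳ-isoʳ B x = let open Setoid (F.F₀ B) in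
    trans (unitorʳ-β x tt π₁) (trans (F.F-resp-≈ (λ _ → Setoid.refl B) x) (F.identity x))

module _ (F G H : SmallFunctor ℓ) where
  open ⋆³ F G H

  private
    families⇒ : ∀ {C D} → ∣ H.F₀ D ∣ → FG.Family C (R.Fun (C ×ₛ D))
    families⇒ {C} {D} z = record
      { at = λ x y h → R.inj x (GH.inj y z idₛ) ((h ×₁ idₛ) ⊙ assocʳ)
      ; at-cong = λ {A} {B} {h = h} {h′} p q r → R.inj-cong {h = (h ×₁ idₛ) ⊙ assocʳ} {(h′ ×₁ idₛ) ⊙ assocʳ}
          p (GH.inj-cong {h = idₛ} {idₛ} q (Setoid.refl (H.F₀ D)) (λ _ → Setoid.refl (B ×ₛ D)))
          (λ (a , (b , d)) → r (a , b) , Setoid.refl D)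
      ; at-slide = λ {A} {A′} {B} {B′} f g x y h → Setoid.sym (R.Fun (C ×ₛ D))
          (moveʳ {f = f} {g} {idₛ} {m = idₛ} {(h ×₁ idₛ) ⊙ assocʳ} {((h ⊙ (f ×₁ g)) ×₁ idₛ) ⊙ assocʳ}
            (Setoid.refl (F.F₀ A′)) (Setoid.refl (G.F₀ B′)) (H.identity z)
            (λ _ → Setoid.refl (C ×ₛ D)))
      }

    families⇐ : ∀ {C D} → ∣ F.F₀ C ∣ → GH.Family D (L.Fun (C ×ₛ D))
    families⇐ {C} {D} x = record
      { at = λ y z h → L.inj (FG.inj x y idₛ) z ((idₛ ×₁ h) ⊙ assocˡ)
      ; at-cong = λ {A} {B} {h = h} {h′} p q r → L.inj-cong {h = (idₛ ×₁ h) ⊙ assocˡ} {(idₛ ×₁ h′) ⊙ assocˡ}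
          (FG.inj-cong {h = idₛ} {idₛ} (Setoid.refl (F.F₀ C)) p (λ _ → Setoid.refl (C ×ₛ A))) q
          (λ ((c , a) , b) → Setoid.refl C , r (a , b))
      ; at-slide = λ {A} {A′} {B} {B′} f g y z h → Setoid.sym (L.Fun (C ×ₛ D))
          (moveˡ {f = idₛ} {f} {g} {m = idₛ} {(idₛ ×₁ h) ⊙ assocˡ} {(idₛ ×₁ (h ⊙ (f ×₁ g))) ⊙ assocˡ}
            (F.identity x) (Setoid.refl (G.F₀ A′)) (Setoid.refl (H.F₀ B′))
            (λ _ → Setoid.refl (C ×ₛ D)))
      }

    bilinear⇒ : L.Bilinear (proj₁ (F ⋆ (G ⋆ H)))
    bilinear⇒ = record
      { on = λ w z → to (FG.elim (families⇒ z)) w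
      ; on-cong = λ {C} {D} {w} {w′} {z} {z′} p q → Setoid.trans (R.Fun (C ×ₛ D))
          (cong (FG.elim (families⇒ z)) p)
          (FG.ext (FG.elim (families⇒ z)) (FG.elim (families⇒ z′)) (λ {A} {B} x y h →
            let open Setoid (R.Fun (C ×ₛ D)) in
            trans (FG.elim-β (families⇒ z) x y h)
            (trans (R.inj-cong {h = (h ×₁ idₛ) ⊙ assocʳ} {(h ×₁ idₛ) ⊙ assocʳ} (Setoid.refl (F.F₀ A))
              (GH.inj-cong {h = idₛ} {idₛ} (Setoid.refl (G.F₀ B)) q (λ _ → Setoid.refl (B ×ₛ D)))
              (λ _ → Setoid.refl (C ×ₛ D)))
            (sym (FG.elim-β (families⇒ z′) x y h)))) w′)
      ; on-natural = λ {C} {C′} {D} {D′} f g w z →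
          FG.ext (FG.elim (families⇒ (to (H.F₁ g) z)) ⊙ F₁ (proj₁ (F ⋆ G)) f)
                 (F₁ (proj₁ (F ⋆ (G ⋆ H))) (f ×₁ g) ⊙ FG.elim (families⇒ z))
            (λ x y h → let open Setoid (R.Fun (C′ ×ₛ D′)) in
            trans (cong (FG.elim (families⇒ (to (H.F₁ g) z))) (FG.inj-action f x y h))
            (trans (FG.elim-β (families⇒ (to (H.F₁ g) z)) x y (f ⊙ h))
            (trans (moveʳ {f = idₛ} {idₛ} {g} {m = idₛ} {((f ⊙ h) ×₁ idₛ) ⊙ assocʳ}
                      {(f ×₁ g) ⊙ ((h ×₁ idₛ) ⊙ assocʳ)}
                      (F.identity x) (G.identity y) (Setoid.refl (H.F₀ D′))
                      (λ _ → Setoid.refl (C′ ×ₛ D′)))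
            (sym (trans (cong (F₁ (proj₁ (F ⋆ (G ⋆ H))) (f ×₁ g)) (FG.elim-β (families⇒ z) x y h))
                        (R.inj-action (f ×₁ g) x (GH.inj y z idₛ) ((h ×₁ idₛ) ⊙ assocʳ)))))))
            w
      }

    bilinear⇐ : R.Bilinear (proj₁ ((F ⋆ G) ⋆ H))
    bilinear⇐ = record
      { on = λ x w → to (GH.elim (families⇐ x)) w
      ; on-cong = λ {C} {D} {x} {x′} {w} {w′} p q → Setoid.trans (L.Fun (C ×ₛ D))
          (cong (GH.elim (families⇐ x)) q)
          (GH.ext (GH.elim (families⇐ x)) (GH.elim (families⇐ x′)) (λ {A} {B} y z h →
            let open Setoid (L.Fun (C ×ₛ D)) in
            trans (GH.elim-β (families⇐ x) y z h)
            (trans (L.inj-cong {h = (idₛ ×₁ h) ⊙ assocˡ} {(idₛ ×₁ h) ⊙ assocˡ}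
              (FG.inj-cong {h = idₛ} {idₛ} p (Setoid.refl (G.F₀ A)) (λ _ → Setoid.refl (C ×ₛ A)))
              (Setoid.refl (H.F₀ B)) (λ _ → Setoid.refl (C ×ₛ D)))
            (sym (GH.elim-β (families⇐ x′) y z h)))) w′)
      ; on-natural = λ {C} {C′} {D} {D′} f g x w →
          GH.ext (GH.elim (families⇐ (to (F.F₁ f) x)) ⊙ F₁ (proj₁ (G ⋆ H)) g)
                 (F₁ (proj₁ ((F ⋆ G) ⋆ H)) (f ×₁ g) ⊙ GH.elim (families⇐ x))
            (λ y z h → let open Setoid (L.Fun (C′ ×ₛ D′)) in
            trans (cong (GH.elim (families⇐ (to (F.F₁ f) x))) (GH.inj-action g y z h))
            (trans (GH.elim-β (families⇐ (to (F.F₁ f) x)) y z (g ⊙ h))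
            (trans (moveˡ {f = f} {idₛ} {idₛ} {m = idₛ} {(idₛ ×₁ (g ⊙ h)) ⊙ assocˡ}
                      {(f ×₁ g) ⊙ ((idₛ ×₁ h) ⊙ assocˡ)}
                      (Setoid.refl (F.F₀ C′)) (G.identity y) (H.identity z)
                      (λ _ → Setoid.refl (C′ ×ₛ D′)))
            (sym (trans (cong (F₁ (proj₁ ((F ⋆ G) ⋆ H)) (f ×₁ g)) (GH.elim-β (families⇐ x) y z h))
                        (L.inj-action (f ×₁ g) (FG.inj x y idₛ) z ((idₛ ×₁ h) ⊙ assocˡ)))))))
            w
      }

  opaque
    associator : NaturalTransformation (proj₁ ((F ⋆ G) ⋆ H)) (proj₁ (F ⋆ (G ⋆ H)))
    associator = L.out bilinear⇒

    associator-β : ∀ {B C C′ D D′} x y (h : Func (C ×ₛ D) C′) z (k : Func (C′ ×ₛ D′) B) →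
                   R.Fun B [ to (η associator B) (L.inj (FG.inj x y h) z k)
                           ≈ R.inj x (GH.inj y z idₛ) (k ⊙ ((h ×₁ idₛ) ⊙ assocʳ)) ]
    associator-β {B} x y h z k = let open Setoid (R.Fun B) in
      trans (L.out-β bilinear⇒ (FG.inj x y h) z k)
      (trans (cong (F₁ (proj₁ (F ⋆ (G ⋆ H))) k) (FG.elim-β (families⇒ z) x y h))
      (R.inj-action k x (GH.inj y z idₛ) ((h ×₁ idₛ) ⊙ assocʳ)))

  opaque
    associator⁻¹ : NaturalTransformation (proj₁ (F ⋆ (G ⋆ H))) (proj₁ ((F ⋆ G) ⋆ H))
    associator⁻¹ = R.out bilinear⇐

    associator⁻¹-β : ∀ {B C C′ D D′} x y z (h : Func (D ×ₛ D′) C′) (k : Func (C ×ₛ C′) B) →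
                     L.Fun B [ to (η associator⁻¹ B) (R.inj x (GH.inj y z h) k)
                             ≈ L.inj (FG.inj x y idₛ) z (k ⊙ ((idₛ ×₁ h) ⊙ assocˡ)) ]
    associator⁻¹-β {B} x y z h k = let open Setoid (L.Fun B) in
      trans (R.out-β bilinear⇐ x (GH.inj y z h) k)
      (trans (cong (F₁ (proj₁ ((F ⋆ G) ⋆ H)) k) (GH.elim-β (families⇐ x) y z h))
      (L.inj-action k (FG.inj x y idₛ) z ((idₛ ×₁ h) ⊙ assocˡ)))

  associator-isoˡ : ∀ B w → L.Fun B [ to (η associator⁻¹ B) (to (η associator B) w) ≈ w ]
  associator-isoˡ B = extˡ (η associator⁻¹ B ⊙ η associator B) idₛ (λ x y h z k →
    let open Setoid (L.Fun B) in
    trans (cong (η associator⁻¹ B) (associator-β x y h z k))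
    (trans (associator⁻¹-β x y z idₛ (k ⊙ ((h ×₁ idₛ) ⊙ assocʳ)))
    (sym (moveˡ {f = idₛ} {idₛ} {idₛ} {m = h} {k}
            {(k ⊙ ((h ×₁ idₛ) ⊙ assocʳ)) ⊙ ((idₛ ×₁ idₛ) ⊙ assocˡ)}
            (F.identity x) (G.identity y) (H.identity z) (λ _ → Setoid.refl B)))))

  associator-isoʳ : ∀ B w → R.Fun B [ to (η associator B) (to (η associator⁻¹ B) w) ≈ w ]
  associator-isoʳ B = extʳ (η associator B ⊙ η associator⁻¹ B) idₛ (λ x y z h k →
    let open Setoid (R.Fun B) in
    trans (cong (η associator B) (associator⁻¹-β x y z h k))
    (trans (associator-β x y idₛ z (k ⊙ ((idₛ ×₁ h) ⊙ assocˡ)))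
    (sym (moveʳ {f = idₛ} {idₛ} {idₛ} {m = h} {k}
            {(k ⊙ ((idₛ ×₁ h) ⊙ assocˡ)) ⊙ ((idₛ ×₁ idₛ) ⊙ assocʳ)}
            (F.identity x) (G.identity y) (H.identity z) (λ _ → Setoid.refl B)))))

module SE {ℓ} = Category (SmallEndo ℓ)

Nat : SmallFunctor ℓ → SmallFunctor ℓ → Set (suc ℓ)
Nat F G = NaturalTransformation (proj₁ F) (proj₁ G)

⋆-bifunctor : Functor (SmallEndo ℓ ×ᶜ SmallEndo ℓ) (SmallEndo ℓ)
⋆-bifunctor {ℓ} = record
  { F₀ = λ (F , G) → F ⋆ G
  ; F₁ = λ { {F , G} {F′ , G′} (σ , τ) → bimap F F′ G G′ σ τ }
  ; identity = λ { {F , G} B → ⋆.ext F G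
      (η (bimap F F G G (SE.id {A = F}) (SE.id {A = G})) B) idₛ
      (bimap-β F F G G (SE.id {A = F}) (SE.id {A = G})) }
  ; homomorphism = λ { {F , G} {F′ , G′} {F″ , G″} {σ , τ} {σ′ , τ′} B →
      let σ″ = SE._∘_ {A = F} {F′} {F″} σ′ σ
          τ″ = SE._∘_ {A = G} {G′} {G″} τ′ τ
          first = η (bimap F F′ G G′ σ τ) B
          second = η (bimap F′ F″ G′ G″ σ′ τ′) B
          open Setoid (⋆.Fun F″ G″ B)
      in ⋆.ext F G (η (bimap F F″ G G″ σ″ τ″) B) (second ⊙ first) (λ {C} {D} x y h →
        trans (bimap-β F F″ G G″ σ″ τ″ x y h)
        (sym (trans (cong second (bimap-β F F′ G G′ σ τ x y h))
                    (bimap-β F′ F″ G′ G″ σ′ τ′ (to (η σ C) x) (to (η τ D) y) h)))) }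
  ; F-resp-≈ = λ { {F , G} {F′ , G′} {σ , τ} {σ′ , τ′} (p , q) B →
      let open Setoid (⋆.Fun F′ G′ B) in
      ⋆.ext F G (η (bimap F F′ G G′ σ τ) B) (η (bimap F F′ G G′ σ′ τ′) B) (λ {C} {D} x y h →
        trans (bimap-β F F′ G G′ σ τ x y h)
        (trans (⋆.inj-cong F′ G′ {h = h} {h} (p C x) (q D y) (λ _ → Setoid.refl B))
        (sym (bimap-β F F′ G G′ σ′ τ′ x y h)))) }
  }

private
  module _ (F G H F′ G′ H′ : SmallFunctor ℓ) (σ : Nat F F′) (τ : Nat G G′) (υ : Nat H H′) where
    private
      module S = ⋆³ F G H
      module T = ⋆³ F′ G′ H′
      στ = bimap F F′ G G′ σ τ
      τυ = bimap G G′ H H′ τ υ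
      left = bimap (F ⋆ G) (F′ ⋆ G′) H H′ στ υ
      right = bimap F F′ (G ⋆ H) (G′ ⋆ H′) σ τυ

    associator-natural : ∀ B w → T.R.Fun B [ to (η (associator F′ G′ H′) B) (to (η left B) w)
                                           ≈ to (η right B) (to (η (associator F G H) B) w) ]
    associator-natural B = S.extˡ (η (associator F′ G′ H′) B ⊙ η left B)
                                  (η right B ⊙ η (associator F G H) B)
      (λ {C} {D} {C′} {D′} x y h z k →
        let open Setoid (T.R.Fun B)
            σx = to (η σ C) x
            τy = to (η τ D) y
            υz = to (η υ D′) z
            m = k ⊙ ((h ×₁ idₛ) ⊙ assocʳ)
        in
        trans (cong (η (associator F′ G′ H′) B)
                (Setoid.trans (T.L.Fun B)
                  (bimap-β (F ⋆ G) (F′ ⋆ G′) H H′ στ υ (S.FG.inj x y h) z k)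
                  (cong (T.L.injˡ υz k) (bimap-β F F′ G G′ σ τ x y h))))
        (trans (associator-β F′ G′ H′ σx τy h υz k)
        (sym (trans (cong (η right B) (associator-β F G H x y h z k))
             (trans (bimap-β F F′ (G ⋆ H) (G′ ⋆ H′) σ τυ x (S.GH.inj y z idₛ) m)
                    (cong (T.R.injʳ σx m) (bimap-β G G′ H H′ τ υ y z idₛ)))))))

  module _ (F G : SmallFunctor ℓ) where
    private
      module S = ⋆³ F Id G
      left = bimap F F (Id ⋆ G) G (SE.id {A = F}) (unitorˡ G)
      right = bimap (F ⋆ Id) F G G (unitorʳ F) (SE.id {A = G})

    triangle′ : ∀ B w → ⋆.Fun F G B [ to (η left B) (to (η (associator F Id G) B) w)
                                    ≈ to (η right B) w ]
    triangle′ B = S.extˡ (η left B ⊙ η (associator F Id G) B) (η right B)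
      (λ {C} {D} {C′} {D′} x a h y k →
        let open Setoid (⋆.Fun F G B)
            m = k ⊙ ((h ×₁ idₛ) ⊙ assocʳ)
        in
        trans (cong (η left B) (associator-β F Id G x a h y k))
        (trans (bimap-β F F (Id ⋆ G) G (SE.id {A = F}) (unitorˡ G) x (S.GH.inj a y idₛ) m)
        (trans (⋆.inj-move F G {f = idₛ} {pairˡ idₛ a} {h = k ⊙ (pairʳ h a ×₁ idₛ)} {m}
                 (S.F.identity x) (Setoid.sym (S.H.F₀ (D ×ₛ D′)) (unitorˡ-β G a y idₛ))
                 (λ _ → Setoid.refl B))
        (sym (trans (bimap-β (F ⋆ Id) F G G (unitorʳ F) (SE.id {A = G}) (S.FG.inj x a h) y k)
             (⋆.inj-move F G {f = pairʳ h a} {idₛ} {h = k ⊙ (pairʳ h a ×₁ idₛ)} {k}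
               (Setoid.sym (S.F.F₀ C′) (unitorʳ-β F x a h)) (S.H.identity y)
               (λ _ → Setoid.refl B)))))))

  module _ (E F G H : SmallFunctor ℓ) where
    private
      module EFG = ⋆³ E F G
      module FGH = ⋆³ F G H
      module EF-G-H = ⋆³ (E ⋆ F) G H
      module E-F-GH = ⋆³ E F (G ⋆ H)
      module E-FG-H = ⋆³ E (F ⋆ G) H
      a₁ = bimap ((E ⋆ F) ⋆ G) (E ⋆ (F ⋆ G)) H H (associator E F G) (SE.id {A = H})
      a₂ = associator E (F ⋆ G) H
      a₃ = bimap E E ((F ⋆ G) ⋆ H) (F ⋆ (G ⋆ H)) (SE.id {A = E}) (associator F G H)
      b₁ = associator (E ⋆ F) G H
      b₂ = associator E F (G ⋆ H)

    pentagon′ : ∀ B w → E-F-GH.R.Fun B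
      [ to (η a₃ B) (to (η a₂ B) (to (η a₁ B) w)) ≈ to (η b₂ B) (to (η b₁ B) w) ]
    pentagon′ B = EF-G-H.L.ext lhs rhs (λ u z l →
        EFG.extˡ (lhs ⊙ EF-G-H.L.injˡ z l) (rhs ⊙ EF-G-H.L.injˡ z l)
          (λ w x h y k → generators w x h y k z l) u)
      where
        open Setoid (E-F-GH.R.Fun B)
        lhs = η a₃ B ⊙ (η a₂ B ⊙ η a₁ B)
        rhs = η b₂ B ⊙ η b₁ B

        generators : ∀ {W X Y Z U V} w x (h : Func (W ×ₛ X) U) y (k : Func (U ×ₛ Y) V) z
                     (l : Func (V ×ₛ Z) B) →
          let t = EF-G-H.L.inj (EFG.L.inj (EFG.FG.inj w x h) y k) z l in to lhs t ≈ to rhs t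
        generators {W} {X} {Y} {Z} w x h y k z l =
          trans (cong (η a₃ B ⊙ η a₂ B)
                  (Setoid.trans (E-FG-H.L.Fun B)
                    (bimap-β ((E ⋆ F) ⋆ G) (E ⋆ (F ⋆ G)) H H (associator E F G) (SE.id {A = H})
                      (EFG.L.inj (EFG.FG.inj w x h) y k) z l)
                    (cong (E-FG-H.L.injˡ z l) (associator-β E F G w x h y k))))
          (trans (cong (η a₃ B) (associator-β E (F ⋆ G) H w (FGH.FG.inj x y idₛ) k′ z l))
          (trans (bimap-β E E ((F ⋆ G) ⋆ H) (F ⋆ (G ⋆ H)) (SE.id {A = E}) (associator F G H)
                   w (FGH.L.inj (FGH.FG.inj x y idₛ) z idₛ) l′)
          (trans (cong (E-F-GH.R.injʳ w l′) (associator-β F G H x y idₛ z idₛ))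
          (trans (E-F-GH.moveʳ {f = idₛ} {idₛ} {idₛ} {m = j} {l′} {n}
                   (E-F-GH.F.identity w) (E-F-GH.G.identity x) (E-F-GH.H.identity _)
                   (λ _ → Setoid.refl B))
          (sym (trans (cong (η b₂ B) (associator-β (E ⋆ F) G H (EFG.FG.inj w x h) y k z l))
                      (associator-β E F (G ⋆ H) w x h (FGH.GH.inj y z idₛ)
                        (l ⊙ ((k ×₁ idₛ) ⊙ assocʳ)))))))))
          where
            k′ = k ⊙ ((h ×₁ idₛ) ⊙ assocʳ)
            l′ = l ⊙ ((k′ ×₁ idₛ) ⊙ assocʳ)
            j : Func (X ×ₛ (Y ×ₛ Z)) ((X ×ₛ Y) ×ₛ Z)
            j = idₛ ⊙ ((idₛ ×₁ idₛ) ⊙ assocʳ)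
            n : Func (W ×ₛ (X ×ₛ (Y ×ₛ Z))) B
            n = (l ⊙ ((k ×₁ idₛ) ⊙ assocʳ)) ⊙ ((h ×₁ idₛ) ⊙ assocʳ)

DayMonoidal : ∀ ℓ → Monoidal (SmallEndo ℓ)
DayMonoidal ℓ = record
  { ⊗ = ⋆-bifunctor
  ; unit = Id
  ; λ⇒ = λ {F} → unitorˡ F
  ; λ⇐ = λ {F} → unitorˡ⁻¹ F
  ; ρ⇒ = λ {F} → unitorʳ F
  ; ρ⇐ = λ {F} → unitorʳ⁻¹ F
  ; α⇒ = λ {F} {G} {H} → associator F G H
  ; α⇐ = λ {F} {G} {H} → associator⁻¹ F G H
  ; λ-isoˡ = λ {F} → unitorˡ-isoˡ F
  ; λ-isoʳ = λ {F} → unitorˡ-isoʳ F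
  ; ρ-isoˡ = λ {F} → unitorʳ-isoˡ F
  ; ρ-isoʳ = λ {F} → unitorʳ-isoʳ F
  ; α-isoˡ = λ {F} {G} {H} → associator-isoˡ F G H
  ; α-isoʳ = λ {F} {G} {H} → associator-isoʳ F G H
  ; λ-natural = λ {F} {G} {σ} B → ⋆.ext Id F
      (η (unitorˡ G) B ⊙ η (bimap Id Id F G (SE.id {A = Id}) σ) B) (η σ B ⊙ η (unitorˡ F) B)
      (λ {_} {D} a x h → let open Setoid (F₀ (proj₁ G) B) in
        trans (cong (η (unitorˡ G) B) (bimap-β Id Id F G (SE.id {A = Id}) σ a x h))
        (trans (unitorˡ-β G a (to (η σ D) x) h)
        (sym (trans (cong (η σ B) (unitorˡ-β F a x h)) (commute σ (pairˡ h a) x)))))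
  ; ρ-natural = λ {F} {G} {σ} B → ⋆.ext F Id
      (η (unitorʳ G) B ⊙ η (bimap F G Id Id σ (SE.id {A = Id})) B) (η σ B ⊙ η (unitorʳ F) B)
      (λ {C} x b h → let open Setoid (F₀ (proj₁ G) B) in
        trans (cong (η (unitorʳ G) B) (bimap-β F G Id Id σ (SE.id {A = Id}) x b h))
        (trans (unitorʳ-β G (to (η σ C) x) b h)
        (sym (trans (cong (η σ B) (unitorʳ-β F x b h)) (commute σ (pairʳ h b) x)))))
  ; α-natural = λ {F} {G} {H} {F′} {G′} {H′} {σ} {τ} {υ} →
      associator-natural F G H F′ G′ H′ σ τ υ
  ; triangle = λ {F} {G} → triangle′ F G
  ; pentagon = λ {E} {F} {G} {H} → pentagon′ E F G H
  }

Id+_⋆- : SmallFunctor ℓ → Functor (SmallEndo ℓ) (SmallEndo ℓ)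
Id+ F ⋆- = unit+_⊗- (DayMonoidal _) SmallEndo-coproducts F

{-# OPTIONS --safe #-}
module Submission where

-- Call S a list object on F if it carries nil : 1 → S and cons : F ⊗ S → S such
-- that, for every X, S ⊗ X is the free (F ⊗ -)-algebra on X, generated through
-- nil and with the structure given by cons.  For X = 1 this says that S is the
-- initial algebra of 1 + F ⊗ -; taking X = S defines append : S ⊗ S → S by
-- recursion, and the monoid laws and the universal property of the free monoid
-- are all instances of uniqueness of recursion.  So the parameter X replaces the
-- closed structure usually invoked to make - ⊗ X preserve initial algebras.
--
-- For Day convolution a list object is the coproduct of the powers F ⋆ⁿ: it is
-- small, and F ⋆ - and - ⋆ X preserve it because a map out of a Day convolution
-- is a bilinear family, which can be given summand by summand.

open import Defs
open import Data.Nat.Base using (ℕ; zero; suc)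
open import Data.Product using (Σ-syntax; _,_; proj₁)
open import Data.Product.Relation.Binary.Pointwise.NonDependent using (_×ₛ_)
open import Data.Unit.Polymorphic using (tt)
open import Function.Bundles using (Func)
open import Level using (Level; _⊔_)
open import Relation.Binary.Bundles using (Setoid)
open import Relation.Binary.PropositionalEquality using (_≡_)
import Relation.Binary.Reasoning.Setoid as SetoidReasoning

open Func using (to; cong)
open Functor using (F₀; F₁)
open NaturalTransformation using (η; commute)

-- Equational reasoning in categories and coherence in monoidal categories.

module CategoryReasoning {o h e : Level} (C : Category o h e) where
  open Category C public

  hom : Obj → Obj → Setoid h e
  hom A B = record { Carrier = A ⇒ B ; _≈_ = _≈_ ; isEquivalence = equiv }

  open module Equiv {A} {B} = Setoid (hom A B) public using (refl; sym; trans)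
  open module Reasoning {A} {B} = SetoidReasoning (hom A B) public

  private
    variable
      A B : Obj
      a b c d f g : A ⇒ B

  infixr 4 refl⟩∘⟨_
  infixl 5 _⟩∘⟨refl

  refl⟩∘⟨_ : f ≈ g → a ∘ f ≈ a ∘ g
  refl⟩∘⟨ p = ∘-resp-≈ refl p

  _⟩∘⟨refl : f ≈ g → f ∘ a ≈ g ∘ a
  p ⟩∘⟨refl = ∘-resp-≈ p refl

  pullˡ : a ∘ b ≈ c → a ∘ (b ∘ f) ≈ c ∘ f
  pullˡ p = trans (sym assoc) (p ⟩∘⟨refl)

  pullʳ : a ∘ b ≈ c → (f ∘ a) ∘ b ≈ f ∘ c
  pullʳ p = trans assoc (refl⟩∘⟨ p)

  pushˡ : c ≈ a ∘ b → c ∘ f ≈ a ∘ (b ∘ f)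
  pushˡ p = sym (pullˡ (sym p))

  extendʳ : a ∘ b ≈ c ∘ d → a ∘ (b ∘ f) ≈ c ∘ (d ∘ f)
  extendʳ p = trans (pullˡ p) assoc

  extendˡ : a ∘ b ≈ c ∘ d → (f ∘ a) ∘ b ≈ (f ∘ c) ∘ d
  extendˡ p = trans assoc (trans (refl⟩∘⟨ p) (sym assoc))

  cancelˡ : a ∘ b ≈ id → a ∘ (b ∘ f) ≈ f
  cancelˡ p = trans (pullˡ p) identityˡ

  cancelʳ : a ∘ b ≈ id → (f ∘ a) ∘ b ≈ f
  cancelʳ p = trans assoc (trans (refl⟩∘⟨ p) identityʳ)

  monic-by-retraction : a ∘ b ≈ id → b ∘ f ≈ b ∘ g → f ≈ g
  monic-by-retraction p q = trans (sym (cancelˡ p)) (trans (refl⟩∘⟨ q) (cancelˡ p))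

  epic-by-section : a ∘ b ≈ id → f ∘ a ≈ g ∘ a → f ≈ g
  epic-by-section p q = trans (sym (cancelʳ p)) (trans (q ⟩∘⟨refl) (cancelʳ p))

module MonoidalReasoning {o h e : Level} {C : Category o h e} (M : Monoidal C) where
  open CategoryReasoning C public
  open Monoidal M public
  private
    module ⊗ = Functor ⊗
    variable
      A B X Y Z : Obj
      f f′ g g′ : A ⇒ B

  infixr 6 _⟩⊗⟨_
  _⟩⊗⟨_ : f ≈ f′ → g ≈ g′ → f ⊗₁ g ≈ f′ ⊗₁ g′
  p ⟩⊗⟨ q = ⊗.F-resp-≈ (p , q)

  ⊗-∘ : (f ⊗₁ f′) ∘ (g ⊗₁ g′) ≈ (f ∘ g) ⊗₁ (f′ ∘ g′)
  ⊗-∘ = sym ⊗.homomorphism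

  ⊗-id : id ⊗₁ id ≈ id {X ⊗₀ Y}
  ⊗-id = ⊗.identity

  split : f ⊗₁ g ≈ (f ⊗₁ id) ∘ (id ⊗₁ g)
  split = trans (sym identityʳ ⟩⊗⟨ sym identityˡ) (sym ⊗-∘)

  split′ : f ⊗₁ g ≈ (id ⊗₁ g) ∘ (f ⊗₁ id)
  split′ = trans (sym identityˡ ⟩⊗⟨ sym identityʳ) (sym ⊗-∘)

  interchange : (f ⊗₁ id) ∘ (id ⊗₁ g) ≈ (id ⊗₁ g) ∘ (f ⊗₁ id)
  interchange = trans (sym split) split′

  id⊗-∘ : (id {X} ⊗₁ f) ∘ (id ⊗₁ g) ≈ id ⊗₁ (f ∘ g)
  id⊗-∘ = trans ⊗-∘ (identityˡ ⟩⊗⟨ refl)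

  ⊗id-∘ : (f ⊗₁ id {X}) ∘ (g ⊗₁ id) ≈ (f ∘ g) ⊗₁ id
  ⊗id-∘ = trans ⊗-∘ (refl ⟩⊗⟨ identityˡ)

  -- By `λ⇒` the functor `unit ⊗₀ -` is naturally isomorphic to the identity functor.
  unit⊗-faithful : id {unit} ⊗₁ f ≈ id ⊗₁ g → f ≈ g
  unit⊗-faithful p = epic-by-section λ-isoʳ
    (trans (sym λ-natural) (trans (refl⟩∘⟨ p) λ-natural))

  ⊗unit-faithful : f ⊗₁ id {unit} ≈ g ⊗₁ id → f ≈ g
  ⊗unit-faithful p = epic-by-section ρ-isoʳ
    (trans (sym ρ-natural) (trans (refl⟩∘⟨ p) ρ-natural))

  α-naturalˡ : α⇒ ∘ ((f ⊗₁ id {Y}) ⊗₁ id {Z}) ≈ (f ⊗₁ id) ∘ α⇒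
  α-naturalˡ = trans α-natural ((refl ⟩⊗⟨ ⊗-id) ⟩∘⟨refl)

  α-naturalʳ : α⇒ ∘ (id {X ⊗₀ Y} ⊗₁ f) ≈ (id ⊗₁ (id ⊗₁ f)) ∘ α⇒
  α-naturalʳ = trans (refl⟩∘⟨ (sym ⊗-id ⟩⊗⟨ refl)) α-natural

  α⇐-naturalˡ : α⇐ ∘ (f ⊗₁ id {Y ⊗₀ Z}) ≈ ((f ⊗₁ id) ⊗₁ id) ∘ α⇐
  α⇐-naturalˡ = monic-by-retraction α-isoˡ (begin
    α⇒ ∘ (α⇐ ∘ (_ ⊗₁ id))           ≈⟨ cancelˡ α-isoʳ ⟩
    _ ⊗₁ id                         ≈⟨ cancelʳ α-isoʳ ⟨
    ((_ ⊗₁ id) ∘ α⇒) ∘ α⇐           ≈⟨ α-naturalˡ ⟩∘⟨refl ⟨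
    (α⇒ ∘ ((_ ⊗₁ id) ⊗₁ id)) ∘ α⇐   ≈⟨ assoc ⟩
    α⇒ ∘ (((_ ⊗₁ id) ⊗₁ id) ∘ α⇐)   ∎)

  -- The pentagon with one associator moved across, in the shape that arises when `append-assoc` is
  -- reassociated by `α⇐`.
  pentagon⇐ : α⇒ ∘ ((α⇒ ⊗₁ id) ∘ α⇐) ≈ (id ⊗₁ α⇐) ∘ α⇒ {A} {B} {X ⊗₀ Y}
  pentagon⇐ = monic-by-retraction (trans id⊗-∘ (trans (refl ⟩⊗⟨ α-isoˡ) ⊗-id)) (begin
    (id ⊗₁ α⇒) ∘ (α⇒ ∘ ((α⇒ ⊗₁ id) ∘ α⇐))   ≈⟨ refl⟩∘⟨ assoc ⟨
    (id ⊗₁ α⇒) ∘ ((α⇒ ∘ (α⇒ ⊗₁ id)) ∘ α⇐)   ≈⟨ pullˡ pentagon ⟩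
    (α⇒ ∘ α⇒) ∘ α⇐                          ≈⟨ cancelʳ α-isoʳ ⟩
    α⇒
      ≈⟨ cancelˡ (trans id⊗-∘ (trans (refl ⟩⊗⟨ α-isoʳ) ⊗-id)) ⟨
    (id ⊗₁ α⇒) ∘ ((id ⊗₁ α⇐) ∘ α⇒)          ∎)

  -- Kelly's coherence lemma: after tensoring with `unit` on the left and precomposing with the
  -- invertible `α⇒` and `α⇒ ⊗₁ id`, it follows from pentagon, triangle and naturality.
  λ-α : λ⇒ ∘ α⇒ ≈ λ⇒ {X} ⊗₁ id {Y}
  λ-α {X} {Y} = unit⊗-faithful (epic-by-section α-isoʳ (epic-by-section
    (trans ⊗id-∘ (trans (α-isoʳ ⟩⊗⟨ refl) ⊗-id)) (begin
    ((id ⊗₁ (λ⇒ ∘ α⇒)) ∘ α⇒) ∘ (α⇒ ⊗₁ id)           ≈⟨ assoc ⟩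
    (id ⊗₁ (λ⇒ ∘ α⇒)) ∘ (α⇒ ∘ (α⇒ ⊗₁ id))           ≈⟨ pushˡ (sym id⊗-∘) ⟩
    (id ⊗₁ λ⇒) ∘ ((id ⊗₁ α⇒) ∘ (α⇒ ∘ (α⇒ ⊗₁ id)))   ≈⟨ refl⟩∘⟨ pentagon ⟩
    (id ⊗₁ λ⇒) ∘ (α⇒ ∘ α⇒)                          ≈⟨ pullˡ triangle ⟩
    (ρ⇒ ⊗₁ id) ∘ α⇒                                 ≈⟨ α-naturalˡ ⟨
    α⇒ ∘ ((ρ⇒ ⊗₁ id) ⊗₁ id)                         ≈⟨ refl⟩∘⟨ (triangle ⟩⊗⟨ refl) ⟨
    α⇒ ∘ (((id ⊗₁ λ⇒) ∘ α⇒) ⊗₁ id)                  ≈⟨ refl⟩∘⟨ ⊗id-∘ ⟨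
    α⇒ ∘ (((id ⊗₁ λ⇒) ⊗₁ id) ∘ (α⇒ ⊗₁ id))          ≈⟨ extendʳ α-natural ⟩
    (id ⊗₁ (λ⇒ ⊗₁ id)) ∘ (α⇒ ∘ (α⇒ ⊗₁ id))          ≈⟨ assoc ⟨
    ((id ⊗₁ (λ⇒ ⊗₁ id)) ∘ α⇒) ∘ (α⇒ ⊗₁ id)          ∎)))

  ρ-α : (id {X} ⊗₁ ρ⇒ {Y}) ∘ α⇒ ≈ ρ⇒
  ρ-α = ⊗unit-faithful (monic-by-retraction α-isoˡ (begin
    α⇒ ∘ (((id ⊗₁ ρ⇒) ∘ α⇒) ⊗₁ id)                          ≈⟨ refl⟩∘⟨ ⊗id-∘ ⟨
    α⇒ ∘ (((id ⊗₁ ρ⇒) ⊗₁ id) ∘ (α⇒ ⊗₁ id))                  ≈⟨ extendʳ α-natural ⟩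
    (id ⊗₁ (ρ⇒ ⊗₁ id)) ∘ (α⇒ ∘ (α⇒ ⊗₁ id))                  ≈⟨ (refl ⟩⊗⟨ triangle) ⟩∘⟨refl ⟨
    (id ⊗₁ ((id ⊗₁ λ⇒) ∘ α⇒)) ∘ (α⇒ ∘ (α⇒ ⊗₁ id))           ≈⟨ pushˡ (sym id⊗-∘) ⟩
    (id ⊗₁ (id ⊗₁ λ⇒)) ∘ ((id ⊗₁ α⇒) ∘ (α⇒ ∘ (α⇒ ⊗₁ id)))   ≈⟨ refl⟩∘⟨ pentagon ⟩
    (id ⊗₁ (id ⊗₁ λ⇒)) ∘ (α⇒ ∘ α⇒)                          ≈⟨ extendʳ α-naturalʳ ⟨
    α⇒ ∘ ((id ⊗₁ λ⇒) ∘ α⇒)                                  ≈⟨ refl⟩∘⟨ triangle ⟩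
    α⇒ ∘ (ρ⇒ ⊗₁ id)                                         ∎))

  λ-unit : λ⇒ ≈ ρ⇒ {unit}
  λ-unit = ⊗unit-faithful (begin
    λ⇒ ⊗₁ id          ≈⟨ λ-α ⟨
    -- Naturality of `λ⇒` at `λ⇒` itself, with one `λ⇒` cancelled, gives `id ⊗₁ λ⇒ ≈ λ⇒`.
    λ⇒ ∘ α⇒           ≈⟨ monic-by-retraction λ-isoˡ λ-natural ⟩∘⟨refl ⟨
    (id ⊗₁ λ⇒) ∘ α⇒   ≈⟨ triangle ⟩
    ρ⇒ ⊗₁ id          ∎)

-- List objects, the free monoid and the initial algebra.

module _ {o h e : Level} {C : Category o h e} (M : Monoidal C) where
  open MonoidalReasoning M

  record ListObject (F : Obj) : Set (o ⊔ h ⊔ e) where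
    field
      list : Obj
      nil  : unit ⇒ list
      cons : F ⊗₀ list ⇒ list
      rec  : ∀ {X Y} → X ⇒ Y → F ⊗₀ Y ⇒ Y → list ⊗₀ X ⇒ Y
      rec-nil  : ∀ {X Y} (g : X ⇒ Y) (c : F ⊗₀ Y ⇒ Y) → rec g c ∘ (nil ⊗₁ id) ≈ g ∘ λ⇒
      rec-cons : ∀ {X Y} (g : X ⇒ Y) (c : F ⊗₀ Y ⇒ Y) →
                 rec g c ∘ (cons ⊗₁ id) ≈ c ∘ ((id ⊗₁ rec g c) ∘ α⇒)
      -- Uniqueness is phrased between two solutions because the proofs below compare maps neither
      -- of which is given as a `rec`.
      rec-ext  : ∀ {X Y} {g : X ⇒ Y} {c : F ⊗₀ Y ⇒ Y} {u v : list ⊗₀ X ⇒ Y} →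
                 u ∘ (nil ⊗₁ id) ≈ g ∘ λ⇒ → u ∘ (cons ⊗₁ id) ≈ c ∘ ((id ⊗₁ u) ∘ α⇒) →
                 v ∘ (nil ⊗₁ id) ≈ g ∘ λ⇒ → v ∘ (cons ⊗₁ id) ≈ c ∘ ((id ⊗₁ v) ∘ α⇒) →
                 u ≈ v

    append : list ⊗₀ list ⇒ list
    append = rec id cons

    append-nil : append ∘ (nil ⊗₁ id) ≈ λ⇒
    append-nil = trans (rec-nil id cons) identityˡ

    append-cons : append ∘ (cons ⊗₁ id) ≈ cons ∘ ((id ⊗₁ append) ∘ α⇒)
    append-cons = rec-cons id cons

    -- Both sides solve the recursion with parameter `unit`, base `nil` and step `cons`.
    append-identityʳ : append ∘ (id ⊗₁ nil) ≈ ρ⇒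
    append-identityʳ = rec-ext
      (begin
        (append ∘ (id ⊗₁ nil)) ∘ (nil ⊗₁ id)   ≈⟨ extendˡ interchange ⟨
        (append ∘ (nil ⊗₁ id)) ∘ (id ⊗₁ nil)   ≈⟨ append-nil ⟩∘⟨refl ⟩
        λ⇒ ∘ (id ⊗₁ nil)                       ≈⟨ λ-natural ⟩
        nil ∘ λ⇒                               ∎)
      (begin
        (append ∘ (id ⊗₁ nil)) ∘ (cons ⊗₁ id)                 ≈⟨ extendˡ interchange ⟨
        (append ∘ (cons ⊗₁ id)) ∘ (id ⊗₁ nil)                 ≈⟨ append-cons ⟩∘⟨refl ⟩
        (cons ∘ ((id ⊗₁ append) ∘ α⇒)) ∘ (id ⊗₁ nil)          ≈⟨ pullʳ (extendˡ α-naturalʳ) ⟩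
        cons ∘ (((id ⊗₁ append) ∘ (id ⊗₁ (id ⊗₁ nil))) ∘ α⇒)  ≈⟨ refl⟩∘⟨ id⊗-∘ ⟩∘⟨refl ⟩
        cons ∘ ((id ⊗₁ (append ∘ (id ⊗₁ nil))) ∘ α⇒)          ∎)
      -- Naturality yields `nil ∘ ρ⇒`, while the recursion asks for `nil ∘ λ⇒`; the unitors agree at
      -- `unit`.
      (trans ρ-natural (refl⟩∘⟨ sym λ-unit))
      (trans ρ-natural (refl⟩∘⟨ sym ρ-α))

    -- Reassociating by `α⇐` exposes the first list as the recursion argument. Both sides then solve
    -- the recursion with parameter `list ⊗₀ list`, base `append` and step `cons`.
    append-assoc : append ∘ (append ⊗₁ id) ≈ append ∘ ((id ⊗₁ append) ∘ α⇒)
    append-assoc = trans (sym (cancelʳ α-isoˡ)) (trans (nested ⟩∘⟨refl) assoc)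
      where
        nested : (append ∘ (append ⊗₁ id)) ∘ α⇐ ≈ append ∘ (id ⊗₁ append)
        nested = rec-ext
          (begin
            ((append ∘ (append ⊗₁ id)) ∘ α⇐) ∘ (nil ⊗₁ id)            ≈⟨ extendˡ α⇐-naturalˡ ⟩
            ((append ∘ (append ⊗₁ id)) ∘ ((nil ⊗₁ id) ⊗₁ id)) ∘ α⇐    ≈⟨ assoc ⟩∘⟨refl ⟩
            (append ∘ ((append ⊗₁ id) ∘ ((nil ⊗₁ id) ⊗₁ id))) ∘ α⇐
              ≈⟨ (refl⟩∘⟨ trans ⊗id-∘ (append-nil ⟩⊗⟨ refl)) ⟩∘⟨refl ⟩
            (append ∘ (λ⇒ ⊗₁ id)) ∘ α⇐                                ≈⟨ (refl⟩∘⟨ λ-α) ⟩∘⟨refl ⟨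
            (append ∘ (λ⇒ ∘ α⇒)) ∘ α⇐                                 ≈⟨ pullʳ (cancelʳ α-isoʳ) ⟩
            append ∘ λ⇒                                               ∎)
          (begin
            ((append ∘ (append ⊗₁ id)) ∘ α⇐) ∘ (cons ⊗₁ id)
              ≈⟨ extendˡ α⇐-naturalˡ ⟩
            ((append ∘ (append ⊗₁ id)) ∘ ((cons ⊗₁ id) ⊗₁ id)) ∘ α⇐
              ≈⟨ pullʳ (trans ⊗id-∘ (append-cons ⟩⊗⟨ refl)) ⟩∘⟨refl ⟩
            (append ∘ ((cons ∘ ((id ⊗₁ append) ∘ α⇒)) ⊗₁ id)) ∘ α⇐
              ≈⟨ (refl⟩∘⟨ trans (sym ⊗id-∘) (refl⟩∘⟨ sym ⊗id-∘)) ⟩∘⟨refl ⟩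
            (append ∘ ((cons ⊗₁ id) ∘ (((id ⊗₁ append) ⊗₁ id) ∘ (α⇒ ⊗₁ id)))) ∘ α⇐
              ≈⟨ pullˡ append-cons ⟩∘⟨refl ⟩
            ((cons ∘ ((id ⊗₁ append) ∘ α⇒)) ∘ (((id ⊗₁ append) ⊗₁ id) ∘ (α⇒ ⊗₁ id))) ∘ α⇐
              ≈⟨ trans (pullʳ (pullʳ (extendʳ α-natural))) (refl⟩∘⟨ pullˡ id⊗-∘) ⟩∘⟨refl ⟩
            (cons ∘ ((id ⊗₁ (append ∘ (append ⊗₁ id))) ∘ (α⇒ ∘ (α⇒ ⊗₁ id)))) ∘ α⇐
              -- The pentagon carries the trailing `α⇐` under `id ⊗₁ -`, where it completes the
              -- recursive call.
              ≈⟨ pullʳ (pullʳ (trans assoc pentagon⇐)) ⟩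
            cons ∘ ((id ⊗₁ (append ∘ (append ⊗₁ id))) ∘ ((id ⊗₁ α⇐) ∘ α⇒))
              ≈⟨ refl⟩∘⟨ pullˡ id⊗-∘ ⟩
            cons ∘ ((id ⊗₁ ((append ∘ (append ⊗₁ id)) ∘ α⇐)) ∘ α⇒)
              ∎)
          (begin
            (append ∘ (id ⊗₁ append)) ∘ (nil ⊗₁ id)   ≈⟨ extendˡ interchange ⟨
            (append ∘ (nil ⊗₁ id)) ∘ (id ⊗₁ append)   ≈⟨ append-nil ⟩∘⟨refl ⟩
            λ⇒ ∘ (id ⊗₁ append)                       ≈⟨ λ-natural ⟩
            append ∘ λ⇒                               ∎)
          (begin
            (append ∘ (id ⊗₁ append)) ∘ (cons ⊗₁ id)                  ≈⟨ extendˡ interchange ⟨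
            (append ∘ (cons ⊗₁ id)) ∘ (id ⊗₁ append)                  ≈⟨ append-cons ⟩∘⟨refl ⟩
            (cons ∘ ((id ⊗₁ append) ∘ α⇒)) ∘ (id ⊗₁ append)
              ≈⟨ pullʳ (extendˡ α-naturalʳ) ⟩
            cons ∘ (((id ⊗₁ append) ∘ (id ⊗₁ (id ⊗₁ append))) ∘ α⇒)   ≈⟨ refl⟩∘⟨ id⊗-∘ ⟩∘⟨refl ⟩
            cons ∘ ((id ⊗₁ (append ∘ (id ⊗₁ append))) ∘ α⇒)           ∎)

    listMonoid : Monoid M
    listMonoid = record
      { carrier = list
      ; mult = append
      ; unit⇒ = nil
      ; mult-assoc = append-assoc
      ; mult-identityˡ = append-nil
      ; mult-identityʳ = append-identityʳ
      }

    foldr : ∀ {Y} → unit ⇒ Y → F ⊗₀ Y ⇒ Y → list ⇒ Y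
    foldr g c = rec g c ∘ ρ⇐

    foldr-ρ : ∀ {Y} (g : unit ⇒ Y) (c : F ⊗₀ Y ⇒ Y) → foldr g c ∘ ρ⇒ ≈ rec g c
    foldr-ρ g c = cancelʳ ρ-isoˡ

    foldr-nil : ∀ {Y} (g : unit ⇒ Y) (c : F ⊗₀ Y ⇒ Y) → foldr g c ∘ nil ≈ g
    foldr-nil g c = epic-by-section ρ-isoʳ (begin
      (foldr g c ∘ nil) ∘ ρ⇒           ≈⟨ extendˡ ρ-natural ⟨
      (foldr g c ∘ ρ⇒) ∘ (nil ⊗₁ id)   ≈⟨ foldr-ρ g c ⟩∘⟨refl ⟩
      rec g c ∘ (nil ⊗₁ id)            ≈⟨ rec-nil g c ⟩
      g ∘ λ⇒                           ≈⟨ refl⟩∘⟨ λ-unit ⟩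
      g ∘ ρ⇒                           ∎)

    foldr-cons : ∀ {Y} (g : unit ⇒ Y) (c : F ⊗₀ Y ⇒ Y) →
                 foldr g c ∘ cons ≈ c ∘ (id ⊗₁ foldr g c)
    foldr-cons g c = epic-by-section ρ-isoʳ (begin
      (foldr g c ∘ cons) ∘ ρ⇒                        ≈⟨ extendˡ ρ-natural ⟨
      (foldr g c ∘ ρ⇒) ∘ (cons ⊗₁ id)                ≈⟨ foldr-ρ g c ⟩∘⟨refl ⟩
      rec g c ∘ (cons ⊗₁ id)                         ≈⟨ rec-cons g c ⟩
      c ∘ ((id ⊗₁ rec g c) ∘ α⇒)                     ≈⟨ refl⟩∘⟨ (refl ⟩⊗⟨ foldr-ρ g c) ⟩∘⟨refl ⟨
      c ∘ ((id ⊗₁ (foldr g c ∘ ρ⇒)) ∘ α⇒)            ≈⟨ refl⟩∘⟨ pushˡ (sym id⊗-∘) ⟩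
      c ∘ ((id ⊗₁ foldr g c) ∘ ((id ⊗₁ ρ⇒) ∘ α⇒))    ≈⟨ refl⟩∘⟨ refl⟩∘⟨ ρ-α ⟩
      c ∘ ((id ⊗₁ foldr g c) ∘ ρ⇒)                   ≈⟨ assoc ⟨
      (c ∘ (id ⊗₁ foldr g c)) ∘ ρ⇒                   ∎)

    -- The composite `u ∘ ρ⇒` solves the recursion with parameter `unit`; `λ-unit` and `ρ-α`
    -- translate the two equations.
    foldr-unique : ∀ {Y} {g : unit ⇒ Y} {c : F ⊗₀ Y ⇒ Y} {u : list ⇒ Y} →
                   u ∘ nil ≈ g → u ∘ cons ≈ c ∘ (id ⊗₁ u) → u ≈ foldr g c
    foldr-unique {g = g} {c} {u} p q = epic-by-section ρ-isoʳ (trans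
      (rec-ext
        (begin
          (u ∘ ρ⇒) ∘ (nil ⊗₁ id)   ≈⟨ extendˡ ρ-natural ⟩
          (u ∘ nil) ∘ ρ⇒           ≈⟨ ∘-resp-≈ p (sym λ-unit) ⟩
          g ∘ λ⇒                   ∎)
        (begin
          (u ∘ ρ⇒) ∘ (cons ⊗₁ id)                ≈⟨ extendˡ ρ-natural ⟩
          (u ∘ cons) ∘ ρ⇒                        ≈⟨ trans (q ⟩∘⟨refl) assoc ⟩
          c ∘ ((id ⊗₁ u) ∘ ρ⇒)                   ≈⟨ refl⟩∘⟨ refl⟩∘⟨ ρ-α ⟨
          c ∘ ((id ⊗₁ u) ∘ ((id ⊗₁ ρ⇒) ∘ α⇒))    ≈⟨ refl⟩∘⟨ pullˡ id⊗-∘ ⟩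
          c ∘ ((id ⊗₁ (u ∘ ρ⇒)) ∘ α⇒)            ∎)
        (rec-nil g c) (rec-cons g c))
      (sym (foldr-ρ g c)))

    singleton : F ⇒ list
    singleton = cons ∘ ((id ⊗₁ nil) ∘ ρ⇐)

    -- This expresses `cons` through the monoid structure and the insertion, so that a monoid
    -- homomorphism is determined by its values on singletons.
    append-singleton : append ∘ (singleton ⊗₁ id) ≈ cons
    append-singleton = begin
      append ∘ ((cons ∘ ((id ⊗₁ nil) ∘ ρ⇐)) ⊗₁ id)
        ≈⟨ refl⟩∘⟨ trans (sym ⊗id-∘) (refl⟩∘⟨ sym ⊗id-∘) ⟩
      append ∘ ((cons ⊗₁ id) ∘ (((id ⊗₁ nil) ⊗₁ id) ∘ (ρ⇐ ⊗₁ id)))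
        ≈⟨ trans (pullˡ append-cons) (pullʳ assoc) ⟩
      cons ∘ ((id ⊗₁ append) ∘ (α⇒ ∘ (((id ⊗₁ nil) ⊗₁ id) ∘ (ρ⇐ ⊗₁ id))))
        ≈⟨ refl⟩∘⟨ refl⟩∘⟨ extendʳ α-natural ⟩
      cons ∘ ((id ⊗₁ append) ∘ ((id ⊗₁ (nil ⊗₁ id)) ∘ (α⇒ ∘ (ρ⇐ ⊗₁ id))))
        ≈⟨ refl⟩∘⟨ pullˡ (trans id⊗-∘ (refl ⟩⊗⟨ append-nil)) ⟩
      cons ∘ ((id ⊗₁ λ⇒) ∘ (α⇒ ∘ (ρ⇐ ⊗₁ id)))
        ≈⟨ refl⟩∘⟨ pullˡ triangle ⟩
      cons ∘ ((ρ⇒ ⊗₁ id) ∘ (ρ⇐ ⊗₁ id))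
        ≈⟨ refl⟩∘⟨ trans ⊗id-∘ (trans (ρ-isoʳ ⟩⊗⟨ refl) ⊗-id) ⟩
      cons ∘ id
        ≈⟨ identityʳ ⟩
      cons ∎

    module _ (G : Monoid M) (f : F ⇒ Monoid.carrier G) where
      private
        module G = Monoid G

      -- Left multiplication along `f` makes the carrier of `G` an algebra for `F ⊗₀ -`; the
      -- extension of `f` is the fold into it.
      concatMap : list ⇒ G.carrier
      concatMap = foldr G.unit⇒ (G.mult ∘ (f ⊗₁ id))

      concatMap-nil : concatMap ∘ nil ≈ G.unit⇒
      concatMap-nil = foldr-nil _ _

      concatMap-cons : concatMap ∘ cons ≈ G.mult ∘ (f ⊗₁ concatMap)
      concatMap-cons = trans (foldr-cons _ _) (pullʳ (sym split))

      concatMap-singleton : concatMap ∘ singleton ≈ f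
      concatMap-singleton = begin
        concatMap ∘ (cons ∘ ((id ⊗₁ nil) ∘ ρ⇐))                 ≈⟨ extendʳ concatMap-cons ⟩
        G.mult ∘ ((f ⊗₁ concatMap) ∘ ((id ⊗₁ nil) ∘ ρ⇐))
          ≈⟨ refl⟩∘⟨ pullˡ (trans ⊗-∘ (identityʳ ⟩⊗⟨ concatMap-nil)) ⟩
        G.mult ∘ ((f ⊗₁ G.unit⇒) ∘ ρ⇐)                          ≈⟨ refl⟩∘⟨ pushˡ split′ ⟩
        G.mult ∘ ((id ⊗₁ G.unit⇒) ∘ ((f ⊗₁ id) ∘ ρ⇐))           ≈⟨ pullˡ G.mult-identityʳ ⟩
        ρ⇒ ∘ ((f ⊗₁ id) ∘ ρ⇐)                                   ≈⟨ extendʳ ρ-natural ⟩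
        f ∘ (ρ⇒ ∘ ρ⇐)
          ≈⟨ trans (refl⟩∘⟨ ρ-isoʳ) identityʳ ⟩
        f                                                       ∎

      -- Both sides solve the recursion with parameter `list`, base `concatMap` and step
      -- `G.mult ∘ (f ⊗₁ id)`. For the right side the two equations rest on the left unit law and
      -- the associativity of `G`.
      concatMap-append : concatMap ∘ append ≈ G.mult ∘ (concatMap ⊗₁ concatMap)
      concatMap-append = rec-ext
        (begin
          (concatMap ∘ append) ∘ (nil ⊗₁ id)   ≈⟨ pullʳ append-nil ⟩
          concatMap ∘ λ⇒                       ∎)
        (begin
          (concatMap ∘ append) ∘ (cons ⊗₁ id)
            ≈⟨ pullʳ append-cons ⟩
          concatMap ∘ (cons ∘ ((id ⊗₁ append) ∘ α⇒))
            ≈⟨ extendʳ (trans concatMap-cons (trans (refl⟩∘⟨ split) (sym assoc))) ⟩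
          (G.mult ∘ (f ⊗₁ id)) ∘ ((id ⊗₁ concatMap) ∘ ((id ⊗₁ append) ∘ α⇒))
            ≈⟨ refl⟩∘⟨ pullˡ id⊗-∘ ⟩
          (G.mult ∘ (f ⊗₁ id)) ∘ ((id ⊗₁ (concatMap ∘ append)) ∘ α⇒)              ∎)
        (begin
          (G.mult ∘ (concatMap ⊗₁ concatMap)) ∘ (nil ⊗₁ id)
            ≈⟨ pullʳ (trans ⊗-∘ (concatMap-nil ⟩⊗⟨ identityʳ)) ⟩
          G.mult ∘ (G.unit⇒ ⊗₁ concatMap)                       ≈⟨ refl⟩∘⟨ split ⟩
          G.mult ∘ ((G.unit⇒ ⊗₁ id) ∘ (id ⊗₁ concatMap))        ≈⟨ pullˡ G.mult-identityˡ ⟩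
          λ⇒ ∘ (id ⊗₁ concatMap)                                ≈⟨ λ-natural ⟩
          concatMap ∘ λ⇒                                        ∎)
        (begin
          (G.mult ∘ (concatMap ⊗₁ concatMap)) ∘ (cons ⊗₁ id)
            ≈⟨ pullʳ (trans ⊗-∘ (concatMap-cons ⟩⊗⟨ trans identityʳ (sym identityˡ))) ⟩
          G.mult ∘ ((G.mult ∘ (f ⊗₁ concatMap)) ⊗₁ (id ∘ concatMap))
            ≈⟨ refl⟩∘⟨ ⊗-∘ ⟨
          G.mult ∘ ((G.mult ⊗₁ id) ∘ ((f ⊗₁ concatMap) ⊗₁ concatMap))
            ≈⟨ trans (extendʳ G.mult-assoc) (refl⟩∘⟨ assoc) ⟩
          G.mult ∘ ((id ⊗₁ G.mult) ∘ (α⇒ ∘ ((f ⊗₁ concatMap) ⊗₁ concatMap)))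
            ≈⟨ refl⟩∘⟨ refl⟩∘⟨ α-natural ⟩
          G.mult ∘ ((id ⊗₁ G.mult) ∘ ((f ⊗₁ (concatMap ⊗₁ concatMap)) ∘ α⇒))
            ≈⟨ refl⟩∘⟨ pullˡ (trans ⊗-∘ (identityˡ ⟩⊗⟨ refl)) ⟩
          G.mult ∘ ((f ⊗₁ (G.mult ∘ (concatMap ⊗₁ concatMap))) ∘ α⇒)
            ≈⟨ trans (refl⟩∘⟨ pushˡ split) (sym assoc) ⟩
          (G.mult ∘ (f ⊗₁ id)) ∘ ((id ⊗₁ (G.mult ∘ (concatMap ⊗₁ concatMap))) ∘ α⇒)
            ∎)

      -- Since `cons` appends to a singleton, preservation of multiplication makes `u` an algebra
      -- homomorphism, and folds are unique.
      concatMap-unique : (u : MonoidHom M listMonoid G) →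
                         MonoidHom.arr u ∘ singleton ≈ f → MonoidHom.arr u ≈ concatMap
      concatMap-unique u p = foldr-unique preserves-unit (begin
          arr ∘ cons                                  ≈⟨ refl⟩∘⟨ append-singleton ⟨
          arr ∘ (append ∘ (singleton ⊗₁ id))          ≈⟨ extendʳ preserves-mult ⟩
          G.mult ∘ ((arr ⊗₁ arr) ∘ (singleton ⊗₁ id)) ≈⟨ refl⟩∘⟨ trans ⊗-∘ (p ⟩⊗⟨ identityʳ) ⟩
          G.mult ∘ (f ⊗₁ arr)                         ≈⟨ trans (refl⟩∘⟨ split) (sym assoc) ⟩
          (G.mult ∘ (f ⊗₁ id)) ∘ (id ⊗₁ arr)          ∎)
        where open MonoidHom u

    freeMonoid : FreeMonoid M F
    freeMonoid = record
      { monoid = listMonoid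
      ; ins = singleton
      ; extend = λ G f → record
        { arr = concatMap G f
        ; preserves-mult = concatMap-append G f
        ; preserves-unit = concatMap-nil G f }
      ; extend-ins = concatMap-singleton
      ; extend-unique = concatMap-unique
      }

    module _ (coproducts : BinaryCoproducts C) where
      open BinaryCoproducts coproducts

      initialAlgebra : InitialAlgebra (unit+_⊗- M coproducts F)
      initialAlgebra = record
        { algebra = record { carrier = list ; structure = [ nil , cons ] }
        ; fold = λ B → let b = Algebra.structure B in foldr (b ∘ i₁) (b ∘ i₂)
        ; fold-hom = λ B → trans
            (unique _ (trans (pullʳ inject₁) (foldr-nil _ _))
                      (trans (pullʳ inject₂) (trans (foldr-cons _ _) assoc)))
            (sym (unique _ (pullʳ inject₁)
                           (pullʳ inject₂)))
        ; fold-unique = λ B u p → foldr-unique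
            (trans (sym (pullʳ inject₁))
              (trans (p ⟩∘⟨refl) (pullʳ inject₁)))
            (trans (sym (pullʳ inject₂))
              (trans (p ⟩∘⟨refl) (trans (pullʳ inject₂) (sym assoc))))
        }

-- List objects from coproducts of tensor powers.

module _ {o h e : Level} (C : Category o h e) where
  open Category C

  -- Kept apart from `IsCoproduct` so that it can be assumed by itself, as for the maps
  -- `(id ⊗₁ ι n) ⊗₁ id` below.
  JointlyEpic : {I : Set} {A : I → Obj} {S : Obj} → (∀ i → A i ⇒ S) → Set (o ⊔ h ⊔ e)
  JointlyEpic {S = S} ι = ∀ {Y} (σ τ : S ⇒ Y) → (∀ i → σ ∘ ι i ≈ τ ∘ ι i) → σ ≈ τ

  record IsCoproduct {I : Set} {A : I → Obj} {S : Obj} (ι : ∀ i → A i ⇒ S)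
                     : Set (o ⊔ h ⊔ e) where
    field
      copair       : ∀ {Y} → (∀ i → A i ⇒ Y) → S ⇒ Y
      copair-ι     : ∀ {Y} (σ : ∀ i → A i ⇒ Y) i → copair σ ∘ ι i ≈ σ i
      jointlyEpic  : JointlyEpic ι

module _ {o h e : Level} {C : Category o h e} (M : Monoidal C) where
  open MonoidalReasoning M

  tensorPower : Obj → ℕ → Obj
  tensorPower F zero    = unit
  tensorPower F (suc n) = F ⊗₀ tensorPower F n

  -- The hypotheses serve in turn: `tensorˡ` to define `cons′`, `tensorʳ` to define `rec′` and show
  -- it unique, `tensorˡʳ` to check its equation for `cons′` one power at a time.
  module _ {F S : Obj} (ι : ∀ n → tensorPower F n ⇒ S)
           (tensorˡ : IsCoproduct C (λ n → id {F} ⊗₁ ι n))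
           (tensorʳ : ∀ X → IsCoproduct C (λ n → ι n ⊗₁ id {X}))
           (tensorˡʳ : ∀ X → JointlyEpic C (λ n → (id {F} ⊗₁ ι n) ⊗₁ id {X})) where
    private
      module ˡ = IsCoproduct tensorˡ
      module ʳ {X} = IsCoproduct (tensorʳ X)

      cons′ : F ⊗₀ S ⇒ S
      cons′ = ˡ.copair (λ n → ι (suc n))

      cons′-ι : ∀ n → cons′ ∘ (id ⊗₁ ι n) ≈ ι (suc n)
      cons′-ι = ˡ.copair-ι (λ n → ι (suc n))

      module _ {X Y : Obj} (g : X ⇒ Y) (c : F ⊗₀ Y ⇒ Y) where

        recₙ : ∀ n → tensorPower F n ⊗₀ X ⇒ Y
        recₙ zero    = g ∘ λ⇒
        recₙ (suc n) = c ∘ ((id ⊗₁ recₙ n) ∘ α⇒)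

        rec′ : S ⊗₀ X ⇒ Y
        rec′ = ʳ.copair recₙ

        rec′-ι : ∀ n → rec′ ∘ (ι n ⊗₁ id) ≈ recₙ n
        rec′-ι = ʳ.copair-ι recₙ

        -- On the n-th power both sides reduce to `recₙ (suc n)`, because `cons′` takes that summand
        -- to the next one.
        rec′-cons : rec′ ∘ (cons′ ⊗₁ id) ≈ c ∘ ((id ⊗₁ rec′) ∘ α⇒)
        rec′-cons = tensorˡʳ X _ _ (λ n → begin
          (rec′ ∘ (cons′ ⊗₁ id)) ∘ ((id ⊗₁ ι n) ⊗₁ id)       ≈⟨ assoc ⟩
          rec′ ∘ ((cons′ ⊗₁ id) ∘ ((id ⊗₁ ι n) ⊗₁ id))
            ≈⟨ refl⟩∘⟨ trans ⊗id-∘ (cons′-ι n ⟩⊗⟨ refl) ⟩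
          rec′ ∘ (ι (suc n) ⊗₁ id)                           ≈⟨ rec′-ι (suc n) ⟩
          c ∘ ((id ⊗₁ recₙ n) ∘ α⇒)
            ≈⟨ refl⟩∘⟨ (refl ⟩⊗⟨ rec′-ι n) ⟩∘⟨refl ⟨
          c ∘ ((id ⊗₁ (rec′ ∘ (ι n ⊗₁ id))) ∘ α⇒)            ≈⟨ refl⟩∘⟨ pushˡ (sym id⊗-∘) ⟩
          c ∘ ((id ⊗₁ rec′) ∘ ((id ⊗₁ (ι n ⊗₁ id)) ∘ α⇒))    ≈⟨ refl⟩∘⟨ refl⟩∘⟨ α-natural ⟨
          c ∘ ((id ⊗₁ rec′) ∘ (α⇒ ∘ ((id ⊗₁ ι n) ⊗₁ id)))
            ≈⟨ trans (refl⟩∘⟨ sym assoc) (sym assoc) ⟩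
          (c ∘ ((id ⊗₁ rec′) ∘ α⇒)) ∘ ((id ⊗₁ ι n) ⊗₁ id)    ∎)

        -- Induction on `n`: `ι (suc n)` factors as `cons′ ∘ (id ⊗₁ ι n)`, so the equation for
        -- `cons′` reduces each power to the preceding one.
        recₙ-unique : (u : S ⊗₀ X ⇒ Y) → u ∘ (ι zero ⊗₁ id) ≈ g ∘ λ⇒ →
                      u ∘ (cons′ ⊗₁ id) ≈ c ∘ ((id ⊗₁ u) ∘ α⇒) →
                      ∀ n → u ∘ (ι n ⊗₁ id) ≈ recₙ n
        recₙ-unique u p q zero    = p
        recₙ-unique u p q (suc n) = begin
          u ∘ (ι (suc n) ⊗₁ id)
            ≈⟨ refl⟩∘⟨ trans ⊗id-∘ (cons′-ι n ⟩⊗⟨ refl) ⟨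
          u ∘ ((cons′ ⊗₁ id) ∘ ((id ⊗₁ ι n) ⊗₁ id))       ≈⟨ trans (pullˡ q) (pullʳ assoc) ⟩
          c ∘ ((id ⊗₁ u) ∘ (α⇒ ∘ ((id ⊗₁ ι n) ⊗₁ id)))    ≈⟨ refl⟩∘⟨ refl⟩∘⟨ α-natural ⟩
          c ∘ ((id ⊗₁ u) ∘ ((id ⊗₁ (ι n ⊗₁ id)) ∘ α⇒))
            ≈⟨ refl⟩∘⟨ pullˡ (trans id⊗-∘ (refl ⟩⊗⟨ recₙ-unique u p q n)) ⟩
          c ∘ ((id ⊗₁ recₙ n) ∘ α⇒)                       ∎

    listOfPowers : ListObject M F
    listOfPowers = record
      { list = S
      ; nil = ι zero
      ; cons = cons′
      ; rec = rec′
      ; rec-nil = λ g c → rec′-ι g c zero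
      ; rec-cons = rec′-cons
      ; rec-ext = λ {_} {_} {g} {c} {u} {v} p q p′ q′ → ʳ.jointlyEpic u v
          (λ n → trans (recₙ-unique g c u p q n) (sym (recₙ-unique g c v p′ q′ n)))
      }

-- Coproducts of small functors and joint epimorphy of their injections.

private
  variable
    ℓ : Level

-- Related pairs share their index by construction, which avoids transport along equalities in `I`.
data ΣEq {I : Set} (A : I → Setoid ℓ ℓ) :
         (Σ[ i ∈ I ] ∣ A i ∣) → (Σ[ i ∈ I ] ∣ A i ∣) → Set ℓ where
  same : ∀ {i x y} → A i [ x ≈ y ] → ΣEq A (i , x) (i , y)

Σₛ : {I : Set} → (I → Setoid ℓ ℓ) → Setoid ℓ ℓ
Σₛ {I = I} A = record
  { Carrier = Σ[ i ∈ I ] ∣ A i ∣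
  ; _≈_ = ΣEq A
  ; isEquivalence = record
    { refl = λ { {i , x} → same (Setoid.refl (A i)) }
    ; sym = λ { {i , x} (same p) → same (Setoid.sym (A i) p) }
    ; trans = λ { {i , x} (same p) (same q) → same (Setoid.trans (A i) p q) } }
  }

inₛ : {I : Set} {A : I → Setoid ℓ ℓ} → ∀ i → Func (A i) (Σₛ A)
inₛ i = record { to = λ x → i , x ; cong = same }

ΣF : {I : Set} → (I → Endofunctor ℓ) → Endofunctor ℓ
ΣF A = record
  { F₀ = λ B → Σₛ (λ i → F₀ (A i) B)
  ; F₁ = λ f → record { to = λ (i , x) → i , to (F₁ (A i) f) x
                      ; cong = λ { {i , _} (same p) → same (cong (F₁ (A i) f) p) } }
  ; identity = λ (i , x) → same (Functor.identity (A i) x)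
  ; homomorphism = λ (i , x) → same (Functor.homomorphism (A i) x)
  ; F-resp-≈ = λ p (i , x) → same (Functor.F-resp-≈ (A i) p x)
  }

module _ {I : Set} (A : I → SmallFunctor ℓ) where
  private
    module A i = Small (A i)

    sum : Endofunctor ℓ
    sum = ΣF (λ i → proj₁ (A i))

    -- The sum is presented over the disjoint union of the object families presenting the summands.
    -- As `I` lies in the lowest universe, this union stays at level `ℓ`.
    ⟦_⟧Σ : (Σ[ i ∈ I ] A.Ob i) → Setoid ℓ ℓ
    ⟦ i , a ⟧Σ = A.⟦_⟧ i a

    open Criterion ⟦_⟧Σ sum

    embed : ∀ i → NaturalTransformation (A.Lan i) Lan
    embed i = A.Lan-factor i Lan record
      { η = λ a → record
        { to = λ x → ⟨ (i , a) , (i , to (η (A.ι i) a) x) , idₛ ⟩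
        ; cong = λ p → ∼-≈ restriction (power∘J (A.⟦_⟧ i a)) (same (cong (η (A.ι i) a) p))
                                         (λ _ → Setoid.refl (A.⟦_⟧ i a)) }
      ; commute = λ {a} {b} f x → ∼-sym (step (proj₁ f , tt)
          (same (Setoid.sym (A.Fun i (A.⟦_⟧ i b)) (commute (A.ι i) f x)))
          (λ _ → Setoid.refl (A.⟦_⟧ i b)))
      }

    s : NaturalTransformation sum Lan
    s = record
      { η = λ B → record
        { to = λ (i , x) → to (η (embed i) B) (to (η (A.decompose i) B) x)
        ; cong = λ { {i , _} (same p) → cong (η (embed i) B) (cong (η (A.decompose i) B) p) } }
      ; commute = λ {B} {D} f (i , x) → Setoid.trans (F₀ Lan D)
          (cong (η (embed i) D) (commute (A.decompose i) f x))
          (commute (embed i) f (to (η (A.decompose i) B) x))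
      }

  ⨁ : SmallFunctor ℓ
  ⨁ = sum , isSmall s (λ { B (i , x) → same (A.compose∘decompose i B x) })

  ⨁-ι : ∀ i → Nat (A i) ⨁
  ⨁-ι i = record
    { η = λ B → inₛ i
    ; commute = λ {_} {B} f x → Setoid.refl (F₀ sum B) }

-- Joint epimorphy of the components at each set, against arbitrary maps of
-- setoids: unlike JointlyEpic, this visibly passes to F ⋆ - and - ⋆ F.
PointwiseEpic : {I : Set} {A : I → SmallFunctor ℓ} {S : SmallFunctor ℓ} →
                (∀ i → Nat (A i) S) → Set (Level.suc ℓ)
PointwiseEpic {ℓ} {A = A} {S} ι =
  ∀ {B Y : Setoid ℓ ℓ} (p q : Func (F₀ (proj₁ S) B) Y) →
  (∀ i x → Y [ to p (to (η (ι i) B) x) ≈ to q (to (η (ι i) B) x) ]) →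
  ∀ w → Y [ to p w ≈ to q w ]

pointwiseEpic⇒jointlyEpic : {I : Set} {A : I → SmallFunctor ℓ} {S : SmallFunctor ℓ}
  {ι : ∀ i → Nat (A i) S} → PointwiseEpic {A = A} {S} ι →
  JointlyEpic (SmallEndo ℓ) {A = A} {S} ι
pointwiseEpic⇒jointlyEpic epic σ τ agree B =
  epic (η σ B) (η τ B) (λ i x → agree i B x)

⨁-pointwiseEpic : {I : Set} (A : I → SmallFunctor ℓ) → PointwiseEpic {A = A} {⨁ A} (⨁-ι A)
⨁-pointwiseEpic A p q agree (i , x) = agree i x

-- Preservation of these coproducts by Day convolution.

module _ {I : Set} {A : I → SmallFunctor ℓ} {S : SmallFunctor ℓ} {ι : ∀ i → Nat (A i) S}
         (epic : PointwiseEpic {A = A} {S} ι) (X : SmallFunctor ℓ) where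

  -- A map out of `X ⋆ S` is determined on the generators `inj x y h`. With `x` and `h` fixed, it
  -- becomes a map of setoids out of `S` at a single set, to which the pointwise hypothesis applies.
  ⋆-pointwiseEpicˡ : PointwiseEpic {A = λ i → X ⋆ A i} {X ⋆ S}
                       (λ i → bimap X X (A i) S (SE.id {A = X}) (ι i))
  ⋆-pointwiseEpicˡ {Y = Y} p q agree = ⋆.ext X S p q (λ x y h →
    epic (p ⊙ ⋆.injʳ X S x h) (q ⊙ ⋆.injʳ X S x h) (λ i a →
      let open Setoid Y
          β = bimap-β X X (A i) S (SE.id {A = X}) (ι i) x a h
      in trans (cong p (Setoid.sym (⋆.Fun X S _) β))
           (trans (agree i (⋆.inj X (A i) x a h)) (cong q β)))
      y)

  ⋆-pointwiseEpicʳ : PointwiseEpic {A = λ i → A i ⋆ X} {S ⋆ X}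
                       (λ i → bimap (A i) S X X (ι i) (SE.id {A = X}))
  ⋆-pointwiseEpicʳ {Y = Y} p q agree = ⋆.ext S X p q (λ y x h →
    epic (p ⊙ ⋆.injˡ S X x h) (q ⊙ ⋆.injˡ S X x h) (λ i a →
      let open Setoid Y
          β = bimap-β (A i) S X X (ι i) (SE.id {A = X}) a x h
      in trans (cong p (Setoid.sym (⋆.Fun S X _) β))
           (trans (agree i (⋆.inj (A i) X a x h)) (cong q β)))
      y)

module _ (F G : SmallFunctor ℓ) (K : Endofunctor ℓ) where
  private
    module FG = ⋆ F G

  -- The passage converse to `Day.out`: evaluation at the generators with identity map component.
  restrict : NaturalTransformation (proj₁ (F ⋆ G)) K → FG.Bilinear K
  restrict σ = record
    { on = λ x y → to (η σ _) (FG.inj x y idₛ)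
    ; on-cong = λ {C} {D} p q → cong (η σ (C ×ₛ D))
        (FG.inj-cong {h = idₛ} {idₛ} p q (λ _ → Setoid.refl (C ×ₛ D)))
    ; on-natural = λ {C} {C′} {D} {D′} f g x y → Setoid.trans (F₀ K (C′ ×ₛ D′))
        (cong (η σ (C′ ×ₛ D′)) (let open Setoid (FG.Fun (C′ ×ₛ D′)) in
          trans (sym (FG.inj-slide f g x y idₛ)) (sym (FG.inj-id (f ×₁ g)))))
        (commute σ (f ×₁ g) (FG.inj x y idₛ))
    }

module _ {I : Set} (A : I → SmallFunctor ℓ) (X : SmallFunctor ℓ) where
  private
    module ˡ = ⋆ X (⨁ A)
    module ʳ = ⋆ (⨁ A) X

    module _ {Y : SmallFunctor ℓ} where

      -- Distributivity over the sum: an element of `⨁ A` carries its index, which selects the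
      -- bilinear family to apply, and `same` keeps related elements in one summand.
      bilinearˡ : (∀ i → Nat (X ⋆ A i) Y) → ˡ.Bilinear (proj₁ Y)
      bilinearˡ σ = record
        { on = λ x (i , a) → t.on i x a
        ; on-cong = λ { p (same {i} q) → t.on-cong i p q }
        ; on-natural = λ f g x (i , a) → t.on-natural i f g x a
        }
        where module t i = ⋆.Bilinear X (A i) (restrict X (A i) (proj₁ Y) (σ i))

      bilinearʳ : (∀ i → Nat (A i ⋆ X) Y) → ʳ.Bilinear (proj₁ Y)
      bilinearʳ σ = record
        { on = λ (i , a) x → t.on i a x
        ; on-cong = λ { (same {i} p) q → t.on-cong i p q }
        ; on-natural = λ f g (i , a) x → t.on-natural i f g a x
        }
        where module t i = ⋆.Bilinear (A i) X (restrict (A i) X (proj₁ Y) (σ i))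

  private
    ιˡ : ∀ i → Nat (X ⋆ A i) (X ⋆ ⨁ A)
    ιˡ i = bimap X X (A i) (⨁ A) (SE.id {A = X}) (⨁-ι A i)

    ιʳ : ∀ i → Nat (A i ⋆ X) (⨁ A ⋆ X)
    ιʳ i = bimap (A i) (⨁ A) X X (⨁-ι A i) (SE.id {A = X})

    module _ {Y : SmallFunctor ℓ} where

      copairˡ : (∀ i → Nat (X ⋆ A i) Y) → Nat (X ⋆ ⨁ A) Y
      copairˡ σ = ˡ.out {K = proj₁ Y} (bilinearˡ {Y} σ)

      copairˡ-ι : (σ : ∀ i → Nat (X ⋆ A i) Y) → ∀ i →
                  SE._≈_ {A = X ⋆ A i} {Y}
                    (SE._∘_ {A = X ⋆ A i} {X ⋆ ⨁ A} {Y} (copairˡ σ) (ιˡ i)) (σ i)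
      copairˡ-ι σ i = ⋆.out-ext X (A i) {K = proj₁ Y}
        (SE._∘_ {A = X ⋆ A i} {X ⋆ ⨁ A} {Y} (copairˡ σ) (ιˡ i)) (σ i) (λ {C} {D} x a →
          let open Setoid (F₀ (proj₁ Y) (C ×ₛ D)) in
          trans (cong (η (copairˡ σ) (C ×ₛ D))
                  (bimap-β X X (A i) (⨁ A) (SE.id {A = X}) (⨁-ι A i) x a idₛ))
          (trans (ˡ.out-β {K = proj₁ Y} (bilinearˡ {Y} σ) x (i , a) idₛ)
          -- `out-β` leaves the action of `Y` on the map component of the generator, here `idₛ`.
          (Functor.identity (proj₁ Y) (to (η (σ i) (C ×ₛ D)) (⋆.inj X (A i) x a idₛ)))))

      copairʳ : (∀ i → Nat (A i ⋆ X) Y) → Nat (⨁ A ⋆ X) Y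
      copairʳ σ = ʳ.out {K = proj₁ Y} (bilinearʳ {Y} σ)

      copairʳ-ι : (σ : ∀ i → Nat (A i ⋆ X) Y) → ∀ i →
                  SE._≈_ {A = A i ⋆ X} {Y}
                    (SE._∘_ {A = A i ⋆ X} {⨁ A ⋆ X} {Y} (copairʳ σ) (ιʳ i)) (σ i)
      copairʳ-ι σ i = ⋆.out-ext (A i) X {K = proj₁ Y}
        (SE._∘_ {A = A i ⋆ X} {⨁ A ⋆ X} {Y} (copairʳ σ) (ιʳ i)) (σ i) (λ {C} {D} a x →
          let open Setoid (F₀ (proj₁ Y) (C ×ₛ D)) in
          trans (cong (η (copairʳ σ) (C ×ₛ D))
                  (bimap-β (A i) (⨁ A) X X (⨁-ι A i) (SE.id {A = X}) a x idₛ))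
          (trans (ʳ.out-β {K = proj₁ Y} (bilinearʳ {Y} σ) (i , a) x idₛ)
          (Functor.identity (proj₁ Y) (to (η (σ i) (C ×ₛ D)) (⋆.inj (A i) X a x idₛ)))))

  ⨁-tensorˡ : IsCoproduct (SmallEndo ℓ) {A = λ i → X ⋆ A i} {X ⋆ ⨁ A} ιˡ
  ⨁-tensorˡ = record
    { copair = λ {Y} → copairˡ {Y}
    ; copair-ι = λ {Y} → copairˡ-ι {Y}
    ; jointlyEpic = λ {Y} → pointwiseEpic⇒jointlyEpic {A = λ i → X ⋆ A i} {X ⋆ ⨁ A} {ιˡ}
        (⋆-pointwiseEpicˡ {A = A} {⨁ A} {⨁-ι A} (⨁-pointwiseEpic A) X) {Y}
    }

  ⨁-tensorʳ : IsCoproduct (SmallEndo ℓ) {A = λ i → A i ⋆ X} {⨁ A ⋆ X} ιʳ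
  ⨁-tensorʳ = record
    { copair = λ {Y} → copairʳ {Y}
    ; copair-ι = λ {Y} → copairʳ-ι {Y}
    ; jointlyEpic = λ {Y} → pointwiseEpic⇒jointlyEpic {A = λ i → A i ⋆ X} {⨁ A ⋆ X} {ιʳ}
        (⋆-pointwiseEpicʳ {A = A} {⨁ A} {⨁-ι A} (⨁-pointwiseEpic A) X) {Y}
    }

-- The list object for Day convolution and the free applicative functor.

dayListObject : (F : SmallFunctor ℓ) → ListObject (DayMonoidal ℓ) F
dayListObject {ℓ} F = listOfPowers (DayMonoidal ℓ) {F} {⨁ P} (⨁-ι P)
    (⨁-tensorˡ P F) (⨁-tensorʳ P) (λ X {Y} → tensorˡʳ X {Y})
  where
    P : ℕ → SmallFunctor ℓ
    P = tensorPower (DayMonoidal ℓ) F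

    Fι : ∀ n → Nat (F ⋆ P n) (F ⋆ ⨁ P)
    Fι n = bimap F F (P n) (⨁ P) (SE.id {A = F}) (⨁-ι P n)

    -- Pointwise epimorphy is carried through `F ⋆ -` and then `- ⋆ X`; only the result is weakened
    -- to joint epimorphy.
    tensorˡʳ : ∀ X → JointlyEpic (SmallEndo ℓ) {A = λ n → (F ⋆ P n) ⋆ X} {(F ⋆ ⨁ P) ⋆ X}
                       (λ n → bimap (F ⋆ P n) (F ⋆ ⨁ P) X X (Fι n) (SE.id {A = X}))
    tensorˡʳ X {Y} = pointwiseEpic⇒jointlyEpic {A = λ n → (F ⋆ P n) ⋆ X} {(F ⋆ ⨁ P) ⋆ X}
      {λ n → bimap (F ⋆ P n) (F ⋆ ⨁ P) X X (Fι n) (SE.id {A = X})}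
      (⋆-pointwiseEpicʳ {A = λ n → F ⋆ P n} {F ⋆ ⨁ P} {Fι}
        (⋆-pointwiseEpicˡ {A = P} {⨁ P} {⨁-ι P} (⨁-pointwiseEpic P) F) X) {Y}

mainTheorem4 : (ℓ : Level) (F : SmallFunctor ℓ) →
    Σ[ μ ∈ InitialAlgebra (Id+ F ⋆-) ]
    Σ[ F* ∈ FreeMonoid (DayMonoidal ℓ) F ]
    FreeMonoid.carrier F* ≡ InitialAlgebra.carrier μ
mainTheorem4 ℓ F =
  -- Both structures are built on the carrier of one list object, so the carriers agree
  -- definitionally.
  ListObject.initialAlgebra list SmallEndo-coproducts , ListObject.freeMonoid list , _≡_.refl
  where list = dayListObject F
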